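{- Every finite non-trivial graph $G$ has a $T$-partition of width at most $2(\operatorname{tw}(G)+1)(9\Delta(G)-1)$ for some tree $T$ with $\Delta(T)\leq 6\Delta(G)$.
   Context: For a graph $G$ and a tree $T$, a $T$-partition of $G$ is a partition $(V_x : x\in V(T))$ of $V(G)$ indexed by the nodes of $T$ (parts may be empty) such that for every edge $vw$ of $G$, if $v\in V_x$ and $w\in V_y$ then $x=y$ or $xy\in E(T)$. Its width is $\max\{|V_x| : x\in V(T)\}$. A graph is non-trivial if it has at least one edge. $\operatorname{tw}(G)$ denotes the treewidth of $G$ and $\Delta(G)$ the maximum degree of $G$. -}

module Defs where

open import Data.Nat using (ℕ; zero; suc; _+_; _*_; _∸_; _⊔_; _≤_; _<_)
open import Data.Fin using (Fin; zero; suc; _≟_)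
open import Data.Bool using (Bool; true; false; if_then_else_)
open import Data.List using (List; []; _∷_; _++_; [_]; length)
open import Data.List.Relation.Unary.Unique.Propositional using (Unique)
open import Data.List.Relation.Unary.Linked using (Linked)
open import Data.Product using (Σ; ∃; _×_; _,_)
open import Data.Sum using (_⊎_)
open import Relation.Nullary using (¬_)
open import Relation.Nullary.Decidable using (⌊_⌋)
open import Relation.Binary.PropositionalEquality using (_≡_)

sumF : ∀ {n} → (Fin n → ℕ) → ℕ
sumF {zero}  f = 0
sumF {suc n} f = f zero + sumF (λ i → f (suc i))

maxF : ∀ {n} → (Fin n → ℕ) → ℕ
maxF {zero}  f = 0
maxF {suc n} f = f zero ⊔ maxF (λ i → f (suc i))

countF : ∀ {n} → (Fin n → Bool) → ℕ
countF p = sumF (λ i → if p i then 1 else 0)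

record Graph : Set where
  field
    n      : ℕ
    adj    : Fin n → Fin n → Bool
    sym    : ∀ x y → adj x y ≡ adj y x
    irrefl : ∀ x → adj x x ≡ false

open Graph public

Vtx : Graph → Set
Vtx G = Fin (n G)

Edge : (G : Graph) → Vtx G → Vtx G → Set
Edge G x y = adj G x y ≡ true

degree : (G : Graph) → Vtx G → ℕ
degree G v = countF (adj G v)

-- Δ(G): maximum degree (0 for the empty graph).
maxDegree : Graph → ℕ
maxDegree G = maxF (degree G)

NonTrivial : Graph → Set
NonTrivial G = Σ (Vtx G) λ x → Σ (Vtx G) λ y → Edge G x y

data WalkIn (G : Graph) (P : Vtx G → Set) : Vtx G → Vtx G → Set where
  here : ∀ {x} → P x → WalkIn G P x x
  step : ∀ {x y z} → P x → Edge G x y → WalkIn G P y z → WalkIn G P x z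

InducesConnected : (G : Graph) → (Vtx G → Set) → Set
InducesConnected G P = ∀ x y → P x → P y → WalkIn G P x y

Connected : Graph → Set
Connected G = InducesConnected G (λ _ → Vtx G)

HasCycle : Graph → Set
HasCycle G =
  Σ (Vtx G) λ x → Σ (List (Vtx G)) λ ys → Σ (Vtx G) λ z →
    1 ≤ length ys ×
    Unique (x ∷ ys ++ [ z ]) ×
    Linked (Edge G) (x ∷ ys ++ [ z ]) ×
    Edge G z x

IsTree : Graph → Set
IsTree T = (0 < n T) × Connected T × ¬ HasCycle T

record TreeDecomposition (G : Graph) : Set where
  field
    tree    : Graph
    isTree  : IsTree tree
    bag     : Vtx tree → Vtx G → Bool
    covV    : ∀ v → Σ (Vtx tree) λ t → bag t v ≡ true
    covE    : ∀ v w → Edge G v w → Σ (Vtx tree) λ t → (bag t v ≡ true × bag t w ≡ true)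
    subtree : ∀ v → InducesConnected tree (λ t → bag t v ≡ true)

tdWidth : ∀ {G} → TreeDecomposition G → ℕ
tdWidth D = maxF (λ t → countF (TreeDecomposition.bag D t)) ∸ 1
  where open TreeDecomposition

IsTreewidth : Graph → ℕ → Set
IsTreewidth G k =
  (Σ (TreeDecomposition G) λ D → tdWidth D ≡ k) ×
  (∀ (D : TreeDecomposition G) → k ≤ tdWidth D)

-- T-partitions: vertex v of G is placed in part V_(f v); parts may be empty.
IsTPartition : (G T : Graph) → (Vtx G → Vtx T) → Set
IsTPartition G T f = ∀ v w → Edge G v w → (f v ≡ f w ⊎ Edge T (f v) (f w))

partWidth : (G T : Graph) → (Vtx G → Vtx T) → ℕ
partWidth G T f = maxF (λ x → countF (λ v → ⌊ f v ≟ x ⌋))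

{-# OPTIONS --safe #-}

-- Write K = k + 1 and Δ = Δ(G). By induction on |U| one shows that for S ⊆ U ⊆ V(G) with
-- 4K ≤ |S| ≤ 12KΔ, the graph G[U] has a tree-partition whose root part R contains S and
-- satisfies 2|R| + 4K ≤ 3|S|, whose root has at most |S|/2K − 1 children, and whose other
-- nodes and parts obey the bounds of the theorem. If U ∖ S is small, it becomes a single
-- child of the root S. If |S| ≤ 12K, the root S gets one child, obtained by applying the
-- induction hypothesis to U ∖ S and (a superset of) the neighbourhood of S. If |S| > 12K,
-- a balanced separation of S with a bag A as separator splits U into two sides; the
-- induction hypothesis is applied to both, with A added to S, and the roots are identified.
-- The bound on |R| and on the number of children of the root is preserved by this step.
module Submission where

open import Defs
open import Data.Bool using (Bool; true; false; if_then_else_; _∧_; _∨_; not) renaming (_≟_ to _≟ᵇ_)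
open import Data.Bool.Properties using (∨-comm; ∨-zeroʳ)
open import Data.Empty using (⊥-elim)
open import Data.Fin using (Fin; zero; suc; toℕ; fromℕ<; _≟_)
open import Data.Fin.Properties using (any?; suc-injective; toℕ-injective; toℕ-fromℕ<; toℕ<n)
open import Data.List using (List; []; _∷_; _++_; [_]; length; allFin)
open import Data.List.Membership.Propositional using (_∈_; _∉_)
open import Data.List.Membership.Propositional.Properties using (∈-allFin)
open import Data.List.Relation.Unary.All using (All; []; _∷_)
import Data.List.Relation.Unary.All as All
import Data.List.Relation.Unary.All.Properties as All
open import Data.List.Relation.Unary.AllPairs using ([]; _∷_)
open import Data.List.Relation.Unary.Any using (here; there) renaming (any? to anyᴸ?)
open import Data.List.Relation.Unary.Linked using (Linked; [-]; _∷_)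
open import Data.List.Relation.Unary.Unique.Propositional using (Unique)
open import Data.Nat using (ℕ; zero; suc; _*_; _+_; _∸_; _≤_; _<_; z≤n; s≤s; s≤s⁻¹; _≤?_; >-nonZero)
open import Data.Nat.Properties hiding (_≟_; suc-injective)
open import Data.Nat.Properties using () renaming (_≟_ to _≟ℕ_)
open import Data.Nat.Tactic.RingSolver using (solve-∀)
open import Data.Product using (Σ; ∃; _×_; _,_; proj₁; proj₂)
open import Data.Sum using (_⊎_; inj₁; inj₂)
open import Data.Unit using (⊤; tt)
open import Function using (_∘_; case_of_)
open import Relation.Nullary using (¬_; Dec; yes; no)
open import Relation.Nullary.Decidable using (⌊_⌋)
open import Relation.Binary.PropositionalEquality
  using (_≡_; _≢_; refl; trans; cong; subst; subst₂) renaming (sym to ≡-sym)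

-- Finite sets and counting

-- The range from 4K to 12KΔ for |S| determines the constants. At the lower end, 4K is the least
-- size at which |S|/2K - 1 permits a child and at which R = S satisfies 2|R| + 4K ≤ 3|S|. At the
-- upper end, |S| ≤ 12KΔ turns the two root bounds into |R| ≤ 18KΔ - 2K = 2K(9Δ - 1) and at most 6Δ
-- - 1 children, which leaves room for the parent once this root hangs below another node. The
-- threshold 12K keeps both kinds of recursive call in the range: at most 12K vertices have at most
-- 12KΔ neighbours, and a third of more than 12K vertices is more than 4K. A neighbourhood that is
-- too small is padded to 4K vertices, which is why a superset is allowed. The slack in the root
-- bounds (the -1 for children, the 4K for |R|) is what pays for adding A on both sides of a
-- separation.

𝟙 : Bool → ℕ
𝟙 b = if b then 1 else 0

_⊆_ : ∀ {m} → (Fin m → Bool) → (Fin m → Bool) → Set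
p ⊆ q = ∀ i → p i ≡ true → q i ≡ true

_∩_ _∪_ _∖_ : ∀ {m} → (Fin m → Bool) → (Fin m → Bool) → Fin m → Bool
(p ∩ q) i = p i ∧ q i
(p ∪ q) i = p i ∨ q i
(p ∖ q) i = p i ∧ not (q i)

infixl 7 _∩_
infixl 6 _∪_ _∖_
infix  4 _⊆_

∧⁻ : ∀ {a b} → a ∧ b ≡ true → a ≡ true × b ≡ true
∧⁻ {true} {true} _ = refl , refl

∧⁺ : ∀ {a b} → a ≡ true → b ≡ true → a ∧ b ≡ true
∧⁺ refl refl = refl

∨⁻ : ∀ {a b} → a ∨ b ≡ true → a ≡ true ⊎ b ≡ true
∨⁻ {true}  _ = inj₁ refl
∨⁻ {false} e = inj₂ e

∨⁺ˡ : ∀ {a b} → a ≡ true → a ∨ b ≡ true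
∨⁺ˡ refl = refl

∨⁺ʳ : ∀ {a b} → b ≡ true → a ∨ b ≡ true
∨⁺ʳ {a} refl = ∨-zeroʳ a

not⁻ : ∀ {a} → not a ≡ true → a ≡ false
not⁻ {false} _ = refl

not⁺ : ∀ {a} → a ≡ false → not a ≡ true
not⁺ refl = refl

true≢false : ∀ {a} → a ≡ true → a ≢ false
true≢false refl ()

¬true⇒false : ∀ {a} → a ≢ true → a ≡ false
¬true⇒false {true}  h = ⊥-elim (h refl)
¬true⇒false {false} _ = refl

bool-cases : ∀ a → a ≡ true ⊎ a ≡ false
bool-cases true  = inj₁ refl
bool-cases false = inj₂ refl

⌊⌋⁻ : ∀ {P : Set} (p? : Dec P) → ⌊ p? ⌋ ≡ true → P
⌊⌋⁻ (yes p) _ = p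

⌊⌋⁺ : ∀ {P : Set} (p? : Dec P) → P → ⌊ p? ⌋ ≡ true
⌊⌋⁺ (yes _) _ = refl
⌊⌋⁺ (no ¬p) p = ⊥-elim (¬p p)

if-true : ∀ {A : Set} {b} {x y : A} → b ≡ true → (if b then x else y) ≡ x
if-true refl = refl

if-false : ∀ {A : Set} {b} {x y : A} → b ≡ false → (if b then x else y) ≡ y
if-false refl = refl

𝟙-mono : ∀ {a b} → (a ≡ true → b ≡ true) → 𝟙 a ≤ 𝟙 b
𝟙-mono {true}  h rewrite h refl = ≤-refl
𝟙-mono {false} _ = z≤n

sumF-mono : ∀ {m} {f g : Fin m → ℕ} → (∀ i → f i ≤ g i) → sumF f ≤ sumF g
sumF-mono {zero}  h = z≤n
sumF-mono {suc m} h = +-mono-≤ (h zero) (sumF-mono (h ∘ suc))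

sumF-+ : ∀ {m} (f g : Fin m → ℕ) → sumF (λ i → f i + g i) ≡ sumF f + sumF g
sumF-+ {zero}  f g = refl
sumF-+ {suc m} f g rewrite sumF-+ (f ∘ suc) (g ∘ suc) =
  interchange (f zero) (g zero) (sumF (f ∘ suc)) (sumF (g ∘ suc))
  where
  interchange : ∀ a b c d → a + b + (c + d) ≡ a + c + (b + d)
  interchange = solve-∀

sumF-* : ∀ {m} c (f : Fin m → ℕ) → sumF (λ i → c * f i) ≡ c * sumF f
sumF-* {zero}  c f = ≡-sym (*-zeroʳ c)
sumF-* {suc m} c f rewrite sumF-* c (f ∘ suc) = ≡-sym (*-distribˡ-+ c (f zero) _)

sumF-0 : ∀ m → sumF {m} (λ _ → 0) ≡ 0
sumF-0 zero    = refl
sumF-0 (suc m) = sumF-0 m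

sumF-swap : ∀ {m m′} (f : Fin m → Fin m′ → ℕ) →
  sumF (λ i → sumF (f i)) ≡ sumF (λ j → sumF (λ i → f i j))
sumF-swap {zero}  {m′} f = ≡-sym (sumF-0 m′)
sumF-swap {suc m}      f rewrite sumF-swap (f ∘ suc) =
  ≡-sym (sumF-+ (f zero) (λ j → sumF (λ i → f (suc i) j)))

term≤sumF : ∀ {m} (f : Fin m → ℕ) i → f i ≤ sumF f
term≤sumF f zero    = m≤m+n _ _
term≤sumF f (suc i) = ≤-trans (term≤sumF (f ∘ suc) i) (m≤n+m _ _)

term≤maxF : ∀ {m} (f : Fin m → ℕ) i → f i ≤ maxF f
term≤maxF f zero    = m≤m⊔n _ _
term≤maxF f (suc i) = ≤-trans (term≤maxF (f ∘ suc) i) (m≤n⊔m _ _)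

maxF-lub : ∀ {m c} {f : Fin m → ℕ} → (∀ i → f i ≤ c) → maxF f ≤ c
maxF-lub {zero}  h = z≤n
maxF-lub {suc m} h = ⊔-lub (h zero) (maxF-lub (h ∘ suc))

countF-mono : ∀ {m} {p q : Fin m → Bool} → p ⊆ q → countF p ≤ countF q
countF-mono h = sumF-mono (λ i → 𝟙-mono (h i))

countF-≤-+ : ∀ {m} (p q r : Fin m → Bool) → (∀ i → 𝟙 (p i) ≤ 𝟙 (q i) + 𝟙 (r i)) →
  countF p ≤ countF q + countF r
countF-≤-+ p q r h = ≤-trans (sumF-mono h) (≤-reflexive (sumF-+ (𝟙 ∘ q) (𝟙 ∘ r)))

countF-+-≤ : ∀ {m} (p q r : Fin m → Bool) → (∀ i → 𝟙 (p i) + 𝟙 (q i) ≤ 𝟙 (r i)) →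
  countF p + countF q ≤ countF r
countF-+-≤ p q r h = ≤-trans (≤-reflexive (≡-sym (sumF-+ (𝟙 ∘ p) (𝟙 ∘ q)))) (sumF-mono h)

countF-+-≤-+ : ∀ {m} (p q r s : Fin m → Bool) →
  (∀ i → 𝟙 (p i) + 𝟙 (q i) ≤ 𝟙 (r i) + 𝟙 (s i)) →
  countF p + countF q ≤ countF r + countF s
countF-+-≤-+ p q r s h = ≤-trans (≤-reflexive (≡-sym (sumF-+ (𝟙 ∘ p) (𝟙 ∘ q))))
  (≤-trans (sumF-mono h) (≤-reflexive (sumF-+ (𝟙 ∘ r) (𝟙 ∘ s))))

countF-∪ : ∀ {m} (p q : Fin m → Bool) → countF (p ∪ q) ≤ countF p + countF q
countF-∪ p q = countF-≤-+ (p ∪ q) p q λ i → 𝟙-∨ (p i) (q i)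
  where
  𝟙-∨ : ∀ a b → 𝟙 (a ∨ b) ≤ 𝟙 a + 𝟙 b
  𝟙-∨ true  b = m≤m+n 1 (𝟙 b)
  𝟙-∨ false b = ≤-refl

countF-empty : ∀ {m} {p : Fin m → Bool} → (∀ i → p i ≡ false) → countF p ≡ 0
countF-empty {zero}  h = refl
countF-empty {suc m} h rewrite h zero = countF-empty (h ∘ suc)

countF-≤1 : ∀ {m} (p : Fin m → Bool) →
  (∀ i j → p i ≡ true → p j ≡ true → i ≡ j) → countF p ≤ 1
countF-≤1 {zero}  p h = z≤n
countF-≤1 {suc m} p h with p zero in e
... | true  = ≤-reflexive (cong suc (countF-empty (λ i → ¬true⇒false λ e′ → 0≢suc (h zero (suc i) e e′))))
  where
  0≢suc : ∀ {i : Fin m} → Fin.zero ≢ suc i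
  0≢suc ()
... | false = countF-≤1 (p ∘ suc) (λ i j a b → suc-injective (h (suc i) (suc j) a b))

preimage : ∀ {m} → (Fin m → ℕ) → ℕ → Fin m → Bool
preimage f x v = ⌊ f v ≟ℕ x ⌋

-- Points of `q` outside `p` are skipped as long as the remaining part of `q` still has `c` points.
-- When it no longer has, `q` itself has exactly `c` points and is the answer.
interpolate : ∀ {m} c (p q : Fin m → Bool) → p ⊆ q → countF p ≤ c → c ≤ countF q →
  Σ (Fin m → Bool) λ r → p ⊆ r × r ⊆ q × countF r ≡ c
interpolate {zero} c p q p⊆q _ c≤ = p , (λ _ e → e) , p⊆q , ≡-sym (n≤0⇒n≡0 c≤)
interpolate {suc m} c p q p⊆q p≤ c≤ with p zero in ep | q zero in eq
... | true  | false = ⊥-elim (true≢false (p⊆q zero ep) eq)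
interpolate {suc m} (suc c) p q p⊆q (s≤s p≤) (s≤s c≤) | true | true
  with r , p⊆r , r⊆q , er ← interpolate c (p ∘ suc) (q ∘ suc) (p⊆q ∘ suc) p≤ c≤ =
  (λ { zero → true ; (suc i) → r i }) ,
  (λ { zero _ → refl ; (suc i) e → p⊆r i e }) ,
  (λ { zero _ → eq ; (suc i) e → r⊆q i e }) , cong suc er
... | false | false
  with r , p⊆r , r⊆q , er ← interpolate c (p ∘ suc) (q ∘ suc) (p⊆q ∘ suc) p≤ c≤ =
  (λ { zero → false ; (suc i) → r i }) ,
  (λ { zero e → ⊥-elim (true≢false e ep) ; (suc i) e → p⊆r i e }) ,
  (λ { zero () ; (suc i) e → r⊆q i e }) , er
... | false | true with c ≤? countF (q ∘ suc)
...   | yes c≤′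
  with r , p⊆r , r⊆q , er ← interpolate c (p ∘ suc) (q ∘ suc) (p⊆q ∘ suc) p≤ c≤′ =
  (λ { zero → false ; (suc i) → r i }) ,
  (λ { zero e → ⊥-elim (true≢false e ep) ; (suc i) e → p⊆r i e }) ,
  (λ { zero () ; (suc i) e → r⊆q i e }) , er
...   | no c≰ = q , p⊆q , (λ _ e → e) , ≤-antisym q≤ c≤q
  where
  c≤q : c ≤ countF q
  c≤q rewrite eq = c≤
  q≤ : countF q ≤ c
  q≤ rewrite eq = ≰⇒> c≰

-- Neighbourhoods of vertex sets

neighbours : (G : Graph) → (Vtx G → Bool) → Vtx G → Bool
neighbours G S w = ⌊ any? (λ v → (S v ∧ adj G v w) ≟ᵇ true) ⌋

neighbours⁺ : ∀ G S {v w} → S v ≡ true → Edge G v w → neighbours G S w ≡ true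
neighbours⁺ G S {v} Sv e = ⌊⌋⁺ (any? _) (v , ∧⁺ Sv e)

-- Double counting: every neighbour receives at least one edge from `S`, and every vertex of `S`
-- sends out at most Δ edges.
count-neighbours : ∀ G S → countF (neighbours G S) ≤ maxDegree G * countF S
count-neighbours G S = begin
  countF (neighbours G S)                             ≤⟨ sumF-mono some-edge ⟩
  sumF (λ w → sumF (λ v → 𝟙 (S v ∧ adj G v w)))      ≡⟨ sumF-swap (λ w v → 𝟙 (S v ∧ adj G v w)) ⟩
  sumF (λ v → sumF (λ w → 𝟙 (S v ∧ adj G v w)))      ≤⟨ sumF-mono degree-bound ⟩
  sumF (λ v → maxDegree G * 𝟙 (S v))                  ≡⟨ sumF-* (maxDegree G) (𝟙 ∘ S) ⟩
  maxDegree G * countF S                              ∎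
  where
  open ≤-Reasoning
  some-edge : ∀ w → 𝟙 (neighbours G S w) ≤ sumF (λ v → 𝟙 (S v ∧ adj G v w))
  some-edge w with any? (λ v → (S v ∧ adj G v w) ≟ᵇ true)
  ... | no _ = z≤n
  ... | yes (v , e) = ≤-trans (≤-reflexive (cong 𝟙 (≡-sym e))) (term≤sumF (λ u → 𝟙 (S u ∧ adj G u w)) v)
  degree-bound : ∀ v → sumF (λ w → 𝟙 (S v ∧ adj G v w)) ≤ maxDegree G * 𝟙 (S v)
  degree-bound v with S v
  ... | true  = ≤-trans (term≤maxF (degree G) v) (≤-reflexive (≡-sym (*-identityʳ _)))
  ... | false = ≤-trans (≤-reflexive (sumF-0 (n G))) z≤n

-- Leaf orders of trees

Edge-sym : ∀ G {x y} → Edge G x y → Edge G y x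
Edge-sym G {x} {y} e = trans (sym G y x) e

-- The head is the leaf added last, and `p` is its only neighbour among the earlier nodes. This
-- makes pruning leaves a structural recursion on trees.
data LeafOrder (T : Graph) : List (Vtx T) → Set where
  root : ∀ r → LeafOrder T [ r ]
  leaf : ∀ {xs} y p → LeafOrder T xs → y ∉ xs → p ∈ xs → Edge T y p →
         (∀ q → q ∈ xs → Edge T y q → q ≡ p) → LeafOrder T (y ∷ xs)

-- The shape mirrors `HasCycle`: putting a node outside `xs` that is adjacent to both ends in front
-- of the path yields a cycle.
record SimplePath (T : Graph) (xs : List (Vtx T)) (p q : Vtx T) : Set where
  constructor path
  field
    inner  : List (Vtx T)
    unique : Unique (p ∷ inner ++ [ q ])
    linked : Linked (Edge T) (p ∷ inner ++ [ q ])
    inside : All (_∈ xs) (p ∷ inner ++ [ q ])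

module _ {T : Graph} {xs : List (Vtx T)} where

  private
    V = Vtx T

  SimplePath-weaken : ∀ {y p q} → SimplePath T xs p q → SimplePath T (y ∷ xs) p q
  SimplePath-weaken (path is u l a) = path is u l (All.map there a)

  fresh : {y : V} {zs : List V} → y ∉ xs → All (_∈ xs) zs → All (y ≢_) zs
  fresh y∉ = All.map λ { z∈ refl → y∉ z∈ }

  SimplePath-cons : ∀ {y p q} → y ∉ xs → Edge T y p → SimplePath T xs p q →
    SimplePath T (y ∷ xs) y q
  SimplePath-cons {p = p} y∉ e (path is u l a) =
    path (p ∷ is) (fresh y∉ a ∷ u) (e ∷ l) (here refl ∷ All.map there a)

  Unique-snoc : ∀ {y : V} zs → Unique zs → All (y ≢_) zs → Unique (zs ++ [ y ])
  Unique-snoc []       _        _        = [] ∷ []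
  Unique-snoc (z ∷ zs) (nz ∷ u) (y≢ ∷ a) =
    All.++⁺ nz ((y≢ ∘ ≡-sym) ∷ []) ∷ Unique-snoc zs u a

  Linked-snoc : ∀ {p q : V} zs → Linked (Edge T) (zs ++ [ p ]) → Edge T p q →
    Linked (Edge T) ((zs ++ [ p ]) ++ [ q ])
  Linked-snoc []           l       e = e ∷ [-]
  Linked-snoc (z ∷ [])     (f ∷ l) e = f ∷ Linked-snoc [] l e
  Linked-snoc (z ∷ w ∷ zs) (f ∷ l) e = f ∷ Linked-snoc (w ∷ zs) l e

  SimplePath-snoc : ∀ {y p q} → y ∉ xs → Edge T p y → SimplePath T xs q p →
    SimplePath T (y ∷ xs) q y
  SimplePath-snoc {p = p} {q} y∉ e (path is u l a) =
    path (is ++ [ p ]) (Unique-snoc (q ∷ is ++ [ p ]) u (fresh y∉ a)) (Linked-snoc (q ∷ is) l e)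
      (All.++⁺ (All.map there a) (here refl ∷ []))

simplePath : ∀ {T xs} → LeafOrder T xs → ∀ {p q} → p ∈ xs → q ∈ xs → p ≢ q → SimplePath T xs p q
simplePath (root r) (here refl) (here refl) p≢q = ⊥-elim (p≢q refl)
simplePath (leaf y p₀ o y∉ p∈ e un) (here refl) (here refl) p≢q = ⊥-elim (p≢q refl)
simplePath (leaf y p₀ o y∉ p∈ e un) {q = q} (here refl) (there q∈) p≢q with p₀ ≟ q
... | yes refl = path [] ((p≢q ∷ []) ∷ [] ∷ []) (e ∷ [-]) (here refl ∷ there q∈ ∷ [])
... | no p₀≢q  = SimplePath-cons y∉ e (simplePath o p∈ q∈ p₀≢q)
simplePath {T} (leaf y p₀ o y∉ p∈ e un) {p = q} (there q∈) (here refl) q≢p with p₀ ≟ q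
... | yes refl = path [] ((q≢p ∷ []) ∷ [] ∷ []) (Edge-sym T e ∷ [-]) (there q∈ ∷ here refl ∷ [])
... | no p₀≢q  = SimplePath-snoc y∉ (Edge-sym T e) (simplePath o q∈ p∈ (p₀≢q ∘ ≡-sym))
simplePath (leaf y p₀ o y∉ p∈ e un) (there p∈′) (there q∈) p≢q =
  SimplePath-weaken (simplePath o p∈′ q∈ p≢q)

module _ {T : Graph} (acyclic : ¬ HasCycle T) where

  -- A second neighbour q of y would close a simple path from p to q into a cycle.
  unique-neighbour : ∀ {xs y p} → LeafOrder T xs → y ∉ xs → p ∈ xs → Edge T y p →
    ∀ q → q ∈ xs → Edge T y q → q ≡ p
  unique-neighbour {p = p} o y∉ p∈ yp q q∈ yq with q ≟ p
  ... | yes q≡p = q≡p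
  ... | no q≢p with path is u l a ← simplePath o p∈ q∈ (q≢p ∘ ≡-sym) =
    ⊥-elim (acyclic (_ , p ∷ is , q , s≤s z≤n , fresh {T} y∉ a ∷ u , yp ∷ l , Edge-sym T yq))

  -- Whenever the walk leaves the listed nodes, it does so from a listed node, so acyclicity makes
  -- the node it enters a new leaf.
  extendAlong : ∀ {xs} → LeafOrder T xs → ∀ {P x z} → x ∈ xs → WalkIn T P x z →
    Σ (List (Vtx T)) λ ys → LeafOrder T ys × (∀ {u} → u ∈ xs → u ∈ ys) × z ∈ ys
  extendAlong {xs} o x∈ (here _) = xs , o , (λ u∈ → u∈) , x∈
  extendAlong {xs} o {x = x} x∈ (step {y = y} _ e w) with anyᴸ? (y ≟_) xs
  ... | yes y∈ = extendAlong o y∈ w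
  ... | no y∉
    with ys , o′ , ⊆ys , z∈ ←
      extendAlong (leaf y x o y∉ x∈ (Edge-sym T e) (unique-neighbour o y∉ x∈ (Edge-sym T e))) (here refl) w =
    ys , o′ , ⊆ys ∘ there , z∈

  leafOrder-⊇ : Connected T → Vtx T → (zs : List (Vtx T)) →
    Σ (List (Vtx T)) λ xs → LeafOrder T xs × (∀ {u} → u ∈ zs → u ∈ xs)
  leafOrder-⊇ conn r []       = [ r ] , root r , λ ()
  leafOrder-⊇ conn r (z ∷ zs) with leafOrder-⊇ conn r zs
  ... | [] , () , _
  ... | x ∷ xs , o , ⊆xs
    with ys , o′ , ⊆ys , z∈ ← extendAlong o (here refl) (conn x z x z) =
    ys , o′ , λ { (here refl) → z∈ ; (there u∈) → ⊆ys (⊆xs u∈) }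

leafOrder : ∀ {T} → IsTree T → Σ (List (Vtx T)) λ xs → LeafOrder T xs × (∀ u → u ∈ xs)
leafOrder {T} (0<n , conn , acyclic)
  with xs , o , ⊆xs ← leafOrder-⊇ acyclic conn (fromℕ< 0<n) (allFin (n T)) =
  xs , o , λ u → ⊆xs (∈-allFin u)

-- Balanced separations

-- The separation has sides A ∪ X and V ∖ X, which meet in A.
record BalancedSeparation (G : Graph) (K : ℕ) (S : Vtx G → Bool) : Set where
  field
    A X      : Vtx G → Bool
    A-small  : countF A ≤ K
    disjoint : ∀ v → X v ≡ true → A v ≡ false
    closed   : ∀ v w → X v ≡ true → Edge G v w → X w ≡ true ⊎ A w ≡ true
    X-light  : 3 * countF (S ∩ X) ≤ 2 * countF S
    rest-light : 3 * countF (S ∖ X ∖ A) ≤ 2 * countF S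

WalkIn-source : ∀ {G P x y} → WalkIn G P x y → P x
WalkIn-source (here p)     = p
WalkIn-source (step p _ _) = p

-- The subtrees hanging below a node t of the remaining tree have been merged into the
-- bag B t; the vertices in B t ∖ bag t then occur in no other remaining bag.
module _ {G : Graph} (D : TreeDecomposition G) where
  open TreeDecomposition D renaming (tree to T)

  record Contracted (xs : List (Vtx T)) (B : Vtx T → Vtx G → Bool) : Set where
    field
      cover     : ∀ v → ∃ λ t → t ∈ xs × B t v ≡ true
      coverEdge : ∀ v w → Edge G v w → ∃ λ t → t ∈ xs × B t v ≡ true × B t w ≡ true
      connected : ∀ v s t → s ∈ xs → t ∈ xs → B s v ≡ true → B t v ≡ true →
                  WalkIn T (λ u → u ∈ xs × B u v ≡ true) s t
      exclusive : ∀ v t → t ∈ xs → B t v ≡ true → bag t v ≡ false →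
                  ∀ s → s ∈ xs → B s v ≡ true → s ≡ t

    -- If `v` lies in the single bag `B t`, then any bag covering an edge at `v` is `B t`; hence
    -- edges can leave `B t ∖ C` at such a vertex only through `C`.
    only-in⇒closed : ∀ {t v} (C : Vtx G → Bool) →
      (∀ s → s ∈ xs → B s v ≡ true → s ≡ t) →
      ∀ w → Edge G v w → (B t ∖ C) w ≡ true ⊎ C w ≡ true
    only-in⇒closed C only w e with coverEdge _ w e
    ... | s , s∈ , Bv , Bw with refl ← only s s∈ Bv with C w
    ...   | true  = inj₂ refl
    ...   | false = inj₁ (∧⁺ Bw refl)

  module Contraction {xs B y p} (c : Contracted (y ∷ xs) B) (y∉ : y ∉ xs) (p∈ : p ∈ xs)
    (unique : ∀ q → q ∈ xs → Edge T y q → q ≡ p) where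
    open Contracted c

    contract : Vtx T → Vtx G → Bool
    contract t v = B t v ∨ (⌊ t ≟ p ⌋ ∧ B y v)

    retract : Vtx T → Vtx T
    retract t with t ≟ y
    ... | yes _ = p
    ... | no _  = t

    retract-y : retract y ≡ p
    retract-y with y ≟ y
    ... | yes _ = refl
    ... | no y≢ = ⊥-elim (y≢ refl)

    retract-∈ : ∀ {t} → t ∈ xs → retract t ≡ t
    retract-∈ {t} t∈ with t ≟ y
    ... | yes refl = ⊥-elim (y∉ t∈)
    ... | no _     = refl

    push : ∀ {t v} → t ∈ y ∷ xs → B t v ≡ true →
      retract t ∈ xs × contract (retract t) v ≡ true
    push {t} {v} t∈ Bt with t ≟ y | t∈
    ... | yes refl | _         = p∈ , ∨⁺ʳ {B p v} (∧⁺ (⌊⌋⁺ (p ≟ p) refl) Bt)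
    ... | no t≢    | here t≡   = ⊥-elim (t≢ t≡)
    ... | no _     | there t∈′ = t∈′ , ∨⁺ˡ Bt

    pull : ∀ {t v} → t ∈ xs → contract t v ≡ true →
      ∃ λ s → s ∈ y ∷ xs × B s v ≡ true × retract s ≡ t
    pull {t} {v} t∈ e with ∨⁻ {B t v} e
    ... | inj₁ Bt = t , there t∈ , Bt , retract-∈ t∈
    ... | inj₂ e′ with t≡p , By ← ∧⁻ e′ =
      y , here refl , By , trans retract-y (≡-sym (⌊⌋⁻ (t ≟ p) t≡p))

    -- A walk from `y` to another bag containing `v` must enter `p`, the only neighbour of `y`. Then
    -- `v` is in `B p` but not in `bag p`, so by `exclusive` it is in no other bag, contradicting
    -- `v` in `B y`.
    only-in-y : ∀ {v} → B y v ≡ true → bag p v ≡ false →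
      ∀ s → s ∈ y ∷ xs → B s v ≡ true → s ≡ y
    only-in-y By ¬p s (here s≡) Bs = s≡
    only-in-y {v} By ¬p s (there s∈) Bs with connected v y s (here refl) (there s∈) By Bs
    ... | here _ = ⊥-elim (y∉ s∈)
    ... | step _ e w with WalkIn-source w
    ...   | here refl , _ = ⊥-elim (true≢false e (irrefl T y))
    ...   | there u∈ , Bu with refl ← unique _ u∈ e
        with refl ← exclusive v p (there p∈) Bu ¬p y (here refl) By = ⊥-elim (y∉ p∈)

    -- Only the edge between `y` and `p` is collapsed; all other steps of the walk survive.
    retractWalk : ∀ {v s t} → WalkIn T (λ u → u ∈ y ∷ xs × B u v ≡ true) s t →
      WalkIn T (λ u → u ∈ xs × contract u v ≡ true) (retract s) (retract t)
    retractWalk (here (s∈ , Bs)) = here (push s∈ Bs)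
    retractWalk {v} {s} {t} (step {y = u} (s∈ , Bs) e w) with s ≟ y | u ≟ y | retractWalk w | push s∈ Bs
    ... | yes refl | yes refl | w′ | _  = w′
    ... | yes refl | no u≢    | w′ | _  with WalkIn-source w
    ...   | here u≡ , _   = ⊥-elim (u≢ u≡)
    ...   | there u∈ , _ with refl ← unique u u∈ e = w′
    retractWalk {v} {s} {t} (step {y = u} (s∈ , Bs) e w) | no s≢ | yes refl | w′ | _ with s∈
    ...   | here s≡   = ⊥-elim (s≢ s≡)
    ...   | there s∈′ with refl ← unique s s∈′ (Edge-sym T e) = w′
    retractWalk {v} {s} {t} (step {y = u} (s∈ , Bs) e w) | no s≢ | no u≢ | w′ | Ps = step Ps e w′

    contracted : Contracted xs contract
    contracted = record
      { cover     = λ v → let t , t∈ , Bt = cover v in retract t , push t∈ Bt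
      ; coverEdge = λ v w e → let t , t∈ , Bv , Bw = coverEdge v w e
                                  t∈′ , Bv′ = push t∈ Bv
                              in retract t , t∈′ , Bv′ , proj₂ (push t∈ Bw)
      ; connected = λ v s t s∈ t∈ Bs Bt → conn (pull s∈ Bs) (pull t∈ Bt)
      ; exclusive = excl
      }
      where
      conn : ∀ {v s t} → (∃ λ s′ → s′ ∈ y ∷ xs × B s′ v ≡ true × retract s′ ≡ s) →
        (∃ λ t′ → t′ ∈ y ∷ xs × B t′ v ≡ true × retract t′ ≡ t) →
        WalkIn T (λ u → u ∈ xs × contract u v ≡ true) s t
      conn (s , s∈ , Bs , refl) (t , t∈ , Bt , refl) = retractWalk (connected _ s t s∈ t∈ Bs Bt)

      excl : ∀ v t → t ∈ xs → contract t v ≡ true → bag t v ≡ false →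
        ∀ s → s ∈ xs → contract s v ≡ true → s ≡ t
      -- Either `v` was in `B t` already and was exclusive to it, or it was merged into `t = p` from
      -- `y`, and then `only-in-y` says that no other bag held it.
      excl v t t∈ e ¬t s s∈ e′ with pull s∈ e′ | ∨⁻ {B t v} e
      ... | s′ , s′∈ , Bs′ , refl | inj₁ Bt
        with refl ← exclusive v t (there t∈) Bt ¬t s′ s′∈ Bs′ = retract-∈ t∈
      ... | s′ , s′∈ , Bs′ , refl | inj₂ e″ with t≡p , By ← ∧⁻ e″
        with refl ← ⌊⌋⁻ (t ≟ p) t≡p
        with refl ← only-in-y By ¬t s′ s′∈ Bs′ = retract-y

  module _ {K : ℕ} (bag≤K : ∀ t → countF (bag t) ≤ K) (S : Vtx G → Bool) where

    private
      W = countF S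

    3*-split : ∀ a b c → a + b ≤ c → c ≤ 3 * b → 3 * a ≤ 2 * c
    3*-split a b c ab≤c c≤3b = +-cancelʳ-≤ (3 * b) _ _ (begin
      3 * a + 3 * b ≡⟨ *-distribˡ-+ 3 a b ⟨
      3 * (a + b)   ≤⟨ *-monoʳ-≤ 3 ab≤c ⟩
      3 * c         ≡⟨ 3c c ⟩
      2 * c + c     ≤⟨ +-monoʳ-≤ (2 * c) c≤3b ⟩
      2 * c + 3 * b ∎)
      where
      open ≤-Reasoning
      3c : ∀ x → 3 * x ≡ 2 * x + x
      3c = solve-∀

    module _ (A : Vtx G → Bool) (A-small : countF A ≤ K) (C : Vtx G → Bool)
      (closed : ∀ v w → (C ∖ A) v ≡ true → Edge G v w → (C ∖ A) w ≡ true ⊎ A w ≡ true)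
      (light : 3 * countF (S ∩ (C ∖ A)) ≤ 2 * W) where

      -- Since `C` is contained in X ∪ A, the part of `S` outside both sets avoids `Y`. A `Y`
      -- carrying a third of `S` therefore leaves at most two thirds there.
      separate-by : (Y : Vtx G → Bool) → Y ⊆ C → W ≤ 3 * countF (S ∩ Y) → BalancedSeparation G K S
      separate-by Y Y⊆C heavy = record
        { A = A ; X = C ∖ A ; A-small = A-small
        ; disjoint = λ v e → not⁻ (proj₂ (∧⁻ {C v} e))
        ; closed = closed
        ; X-light = light
        ; rest-light = 3*-split (countF (S ∖ (C ∖ A) ∖ A)) (countF (S ∩ Y)) W
            (countF-+-≤ (S ∖ (C ∖ A) ∖ A) (S ∩ Y) S λ v → pointwise (S v) (C v) (A v) (Y v) (Y⊆C v)) heavy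
        }
        where
        pointwise : ∀ s c a y → (y ≡ true → c ≡ true) →
          𝟙 ((s ∧ not (c ∧ not a)) ∧ not a) + 𝟙 (s ∧ y) ≤ 𝟙 s
        pointwise false c     a     y     h = z≤n
        pointwise true  true  true  true  h = ≤-refl
        pointwise true  true  true  false h = z≤n
        pointwise true  true  false true  h = ≤-refl
        pointwise true  true  false false h = z≤n
        pointwise true  false true  true  h with () ← h refl
        pointwise true  false true  false h = z≤n
        pointwise true  false false true  h with () ← h refl
        pointwise true  false false false h = ≤-refl

    -- Leaves are merged into their parents until a merged part first carries more than a
    -- third of S; some bag next to that part is then a balanced separator.
    separate : ∀ {xs} → LeafOrder T xs → ∀ {B} → Contracted xs B →
      (∀ t → t ∈ xs → 3 * countF (S ∩ (B t ∖ bag t)) ≤ W) → BalancedSeparation G K S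
    -- The last bag covers every vertex, so `S` itself serves as the heavy set.
    separate (root r) {B} c light = separate-by (bag r) (bag≤K r) (B r)
      (λ v w v∈ → only-in⇒closed (bag r) (λ { s (here refl) _ → refl }) w)
      (≤-trans (light r (here refl)) (m≤m+n W _)) S S⊆B
      (≤-trans (countF-mono {p = S} (λ v e → ∧⁺ e e)) (m≤m+n _ _))
      where
      open Contracted c
      S⊆B : S ⊆ B r
      S⊆B v _ with cover v
      ... | _ , here refl , Bv = Bv
    separate (leaf {xs} y p o y∉ p∈ _ unique) {B} c light
      with 3 * countF (S ∩ (contract p ∖ bag p)) ≤? W | 3 * countF (S ∩ (contract p ∖ bag p)) ≤? 2 * W
      where open Contraction c y∉ p∈ unique
    ... | yes ≤W | _ = separate o contracted light′
      where
      open Contraction c y∉ p∈ unique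
      light′ : ∀ t → t ∈ xs → 3 * countF (S ∩ (contract t ∖ bag t)) ≤ W
      light′ t t∈ = case t ≟ p of λ where
          (yes t≡p) → subst (λ u → 3 * countF (S ∩ (contract u ∖ bag u)) ≤ W) (≡-sym t≡p) ≤W
          (no t≢p)  → ≤-trans (*-monoʳ-≤ 3 (countF-mono (shrink t≢p))) (light t (there t∈))
        where
        shrink : t ≢ p → S ∩ (contract t ∖ bag t) ⊆ S ∩ (B t ∖ bag t)
        shrink t≢p v e with Sv , e′ ← ∧⁻ {S v} e with ce , be ← ∧⁻ {contract t v} e′ with ∨⁻ {B t v} ce
        ... | inj₁ Bt = ∧⁺ Sv (∧⁺ Bt be)
        ... | inj₂ t≡ = ⊥-elim (t≢p (⌊⌋⁻ (t ≟ p) (proj₁ (∧⁻ t≡))))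
    ... | no ≰W | yes ≤2W = separate-by (bag p) (bag≤K p) (contract p)
        (λ v w v∈ → let Cv , ¬p = ∧⁻ v∈ in
          Contracted.only-in⇒closed contracted (bag p) (Contracted.exclusive contracted v p p∈ Cv (not⁻ ¬p)) w)
        ≤2W (contract p ∖ bag p) (λ v e → proj₁ (∧⁻ e)) (<⇒≤ (≰⇒> ≰W))
      where open Contraction c y∉ p∈ unique
    -- Too heavy to be cut off at `p` as a whole. The contribution of `B p` is at most a third by
    -- `light`, so more than a third comes from `B y` outside `bag p`.
    ... | no ≰W | no ≰2W = by-y
      where
      open Contraction c y∉ p∈ unique
      open Contracted c
      Y = B y ∖ bag p

      Y-heavy : W ≤ 3 * countF (S ∩ Y)
      Y-heavy = +-cancelˡ-≤ W _ _ (begin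
        W + W                                           ≡⟨ cong (W +_) (+-identityʳ W) ⟨
        2 * W                                           ≤⟨ <⇒≤ (≰⇒> ≰2W) ⟩
        3 * countF (S ∩ (contract p ∖ bag p))           ≤⟨ *-monoʳ-≤ 3 split ⟩
        3 * (countF (S ∩ (B p ∖ bag p)) + countF (S ∩ Y)) ≡⟨ *-distribˡ-+ 3 (countF (S ∩ (B p ∖ bag p))) _ ⟩
        3 * countF (S ∩ (B p ∖ bag p)) + 3 * countF (S ∩ Y) ≤⟨ +-monoˡ-≤ _ (light p (there p∈)) ⟩
        W + 3 * countF (S ∩ Y)                          ∎)
        where
        open ≤-Reasoning
        pointwise : ∀ s b q y′ a → 𝟙 (s ∧ ((b ∨ (q ∧ y′)) ∧ not a)) ≤ 𝟙 (s ∧ (b ∧ not a)) + 𝟙 (s ∧ (y′ ∧ not a))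
        pointwise false b     q     y′    a     = z≤n
        pointwise true  true  q     y′    a     = m≤m+n _ _
        pointwise true  false false y′    a     = z≤n
        pointwise true  false true  y′    a     = ≤-refl
        split : countF (S ∩ (contract p ∖ bag p)) ≤ countF (S ∩ (B p ∖ bag p)) + countF (S ∩ Y)
        split = countF-≤-+ (S ∩ (contract p ∖ bag p)) (S ∩ (B p ∖ bag p)) (S ∩ Y)
          λ v → pointwise (S v) (B p v) ⌊ p ≟ p ⌋ (B y v) (bag p v)

      by-y : BalancedSeparation G K S
      by-y with 3 * countF (S ∩ Y) ≤? 2 * W
      ... | yes ≤2W′ = separate-by (bag p) (bag≤K p) (B y)
          (λ v w v∈ → let By , ¬p = ∧⁻ v∈ in only-in⇒closed (bag p) (only-in-y By (not⁻ ¬p)) w)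
          ≤2W′ Y (λ v e → proj₁ (∧⁻ e)) Y-heavy
      -- Here `B y ∖ bag p` exceeds two thirds, so the cut is made at `y` instead: `B y ∖ bag y` has
      -- at most a third by `light`, and `B y` still contains the heavy set `Y`.
      ... | no _ = separate-by (bag y) (bag≤K y) (B y)
          (λ v w v∈ → let By , ¬y = ∧⁻ v∈ in only-in⇒closed (bag y) (exclusive v y (here refl) By (not⁻ ¬y)) w)
          (≤-trans (light y (here refl)) (m≤m+n W _)) Y (λ v e → proj₁ (∧⁻ e)) Y-heavy

balancedSeparation : ∀ {G K} (D : TreeDecomposition G) →
  (∀ t → countF (TreeDecomposition.bag D t) ≤ K) → ∀ S → BalancedSeparation G K S
balancedSeparation {G} D bag≤K S with xs , o , ∈xs ← leafOrder (TreeDecomposition.isTree D) =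
  separate D bag≤K S o initial light
  where
  open TreeDecomposition D
  restrict : ∀ {P : Vtx tree → Set} {s t} → WalkIn tree P s t → WalkIn tree (λ u → u ∈ xs × P u) s t
  restrict (here p)     = here (∈xs _ , p)
  restrict (step p e w) = step (∈xs _ , p) e (restrict w)
  initial : Contracted D xs bag
  initial = record
    { cover     = λ v → let t , b = covV v in t , ∈xs t , b
    ; coverEdge = λ v w e → let t , bv , bw = covE v w e in t , ∈xs t , bv , bw
    ; connected = λ v s t _ _ bs bt → restrict (subtree v s t bs bt)
    ; exclusive = λ v t _ bt ¬bt → ⊥-elim (true≢false bt ¬bt)
    }
  light : ∀ t → t ∈ xs → 3 * countF (S ∩ (bag t ∖ bag t)) ≤ countF S
  empty : ∀ s b → s ∧ (b ∧ not b) ≡ false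
  empty true  true  = refl
  empty true  false = refl
  empty false b     = refl
  light t _ = ≤-trans (≤-reflexive (cong (3 *_) (countF-empty (λ v → empty (S v) (bag t v))))) z≤n

-- Trees given by parent lists

-- A list l encodes a rooted tree with nodes 0, …, length l and root 0: an entry p with
-- tail l says that node length l + 1 is a child of p. Labels are stable under _∷_.
childOf : List ℕ → ℕ → ℕ → Bool
childOf []      i j = false
childOf (p ∷ l) i j = (⌊ i ≟ℕ p ⌋ ∧ ⌊ j ≟ℕ suc (length l) ⌋) ∨ childOf l i j

Valid : List ℕ → Set
Valid []      = ⊤
Valid (p ∷ l) = p ≤ length l × Valid l

children : ℕ → List ℕ → ℕ
children x []      = 0
children x (p ∷ l) = 𝟙 ⌊ x ≟ℕ p ⌋ + children x l

childOf-head : ∀ p l → childOf (p ∷ l) p (suc (length l)) ≡ true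
childOf-head p l = ∨⁺ˡ (∧⁺ (⌊⌋⁺ (p ≟ℕ p) refl) (⌊⌋⁺ (suc (length l) ≟ℕ suc (length l)) refl))

childOf-tail : ∀ p l {i j} → childOf l i j ≡ true → childOf (p ∷ l) i j ≡ true
childOf-tail p l {i} {j} e = ∨⁺ʳ {⌊ i ≟ℕ p ⌋ ∧ ⌊ j ≟ℕ suc (length l) ⌋} e

childOf⁻ : ∀ p l {i j} → childOf (p ∷ l) i j ≡ true →
  (i ≡ p × j ≡ suc (length l)) ⊎ childOf l i j ≡ true
childOf⁻ p l {i} {j} e with ∨⁻ {⌊ i ≟ℕ p ⌋ ∧ ⌊ j ≟ℕ suc (length l) ⌋} e
... | inj₂ e′ = inj₂ e′
... | inj₁ e′ with a , b ← ∧⁻ e′ = inj₁ (⌊⌋⁻ (i ≟ℕ p) a , ⌊⌋⁻ (j ≟ℕ suc (length l)) b)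

childOf-bounds : ∀ l {i j} → Valid l → childOf l i j ≡ true → i < j × j ≤ length l
childOf-bounds (p ∷ l) (p≤ , v) e with childOf⁻ p l e
... | inj₁ (refl , refl) = s≤s p≤ , ≤-refl
... | inj₂ e′ with i<j , j≤ ← childOf-bounds l v e′ = i<j , m≤n⇒m≤1+n j≤

parent-unique : ∀ l {i i′ j} → Valid l → childOf l i j ≡ true → childOf l i′ j ≡ true → i ≡ i′
parent-unique (p ∷ l) (p≤ , v) e e′ with childOf⁻ p l e | childOf⁻ p l e′
... | inj₁ (refl , refl) | inj₁ (refl , _) = refl
... | inj₁ (refl , refl) | inj₂ f = ⊥-elim (<-irrefl refl (proj₂ (childOf-bounds l v f)))
... | inj₂ f | inj₁ (refl , refl) = ⊥-elim (<-irrefl refl (proj₂ (childOf-bounds l v f)))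
... | inj₂ f | inj₂ f′ = parent-unique l v f f′

parent-exists : ∀ l j → j < length l → ∃ λ i → childOf l i (suc j) ≡ true
parent-exists (p ∷ l) j (s≤s j≤) with j ≟ℕ length l
... | yes refl = p , childOf-head p l
... | no j≢ with i , e ← parent-exists l j (≤∧≢⇒< j≤ j≢) = i , childOf-tail p l e

children-fresh : ∀ l {x} → Valid l → length l < x → children x l ≡ 0
children-fresh []      _        _ = refl
children-fresh (p ∷ l) {x} (p≤ , v) len< with x ≟ℕ p
... | yes refl = ⊥-elim (<-irrefl refl (≤-trans len< (m≤n⇒m≤1+n p≤)))
... | no _     = children-fresh l v (<⇒≤ len<)

children-≢ : ∀ {x p} l → x ≢ p → children x (p ∷ l) ≡ children x l
children-≢ {x} {p} l x≢p with x ≟ℕ p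
... | yes x≡p = ⊥-elim (x≢p x≡p)
... | no _    = refl

children-≡ : ∀ p l → children p (p ∷ l) ≡ suc (children p l)
children-≡ p l with p ≟ℕ p
... | yes _   = refl
... | no p≢p = ⊥-elim (p≢p refl)

count-children : ∀ {m} l v → countF {m} (λ y → childOf l v (toℕ y)) ≤ children v l
count-children {m} []      v = ≤-reflexive (countF-empty {m} (λ _ → refl))
count-children {m} (p ∷ l) v =
  ≤-trans (countF-∪ {m} (λ y → ⌊ v ≟ℕ p ⌋ ∧ ⌊ toℕ y ≟ℕ suc (length l) ⌋) (λ y → childOf l v (toℕ y)))
          (+-mono-≤ head (count-children {m} l v))
  where
  head : countF {m} (λ y → ⌊ v ≟ℕ p ⌋ ∧ ⌊ toℕ y ≟ℕ suc (length l) ⌋) ≤ 𝟙 ⌊ v ≟ℕ p ⌋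
  head with v ≟ℕ p
  ... | no _  = ≤-reflexive (countF-empty {m} (λ _ → refl))
  ... | yes _ = countF-≤1 {m} _ λ i j a b → toℕ-injective
    (trans (⌊⌋⁻ (toℕ i ≟ℕ suc (length l)) a) (≡-sym (⌊⌋⁻ (toℕ j ≟ℕ suc (length l)) b)))

module ParentTree (l : List ℕ) (valid : Valid l) where

  Node : Set
  Node = Fin (suc (length l))

  T : Graph
  T = record
    { n      = suc (length l)
    ; adj    = λ x y → childOf l (toℕ x) (toℕ y) ∨ childOf l (toℕ y) (toℕ x)
    ; sym    = λ x y → ∨-comm (childOf l (toℕ x) (toℕ y)) _
    ; irrefl = λ x → ¬true⇒false (no-loop x)
    }
    where
    no-loop : ∀ (x : Node) → childOf l (toℕ x) (toℕ x) ∨ childOf l (toℕ x) (toℕ x) ≢ true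
    no-loop x e with ∨⁻ {childOf l (toℕ x) (toℕ x)} e
    ... | inj₁ f = <-irrefl refl (proj₁ (childOf-bounds l valid f))
    ... | inj₂ f = <-irrefl refl (proj₁ (childOf-bounds l valid f))

  Parent : Node → Node → Set
  Parent x y = childOf l (toℕ x) (toℕ y) ≡ true

  edge⁺ : ∀ {x y} → Parent x y → Edge T x y
  edge⁺ = ∨⁺ˡ

  edge⁺′ : ∀ {x y} → Parent y x → Edge T x y
  edge⁺′ {x} {y} = ∨⁺ʳ {childOf l (toℕ x) (toℕ y)}

  edge⁻ : ∀ {x y} → Edge T x y → Parent x y ⊎ Parent y x
  edge⁻ {x} {y} = ∨⁻ {childOf l (toℕ x) (toℕ y)}

  Parent-< : ∀ {x y} → Parent x y → toℕ x < toℕ y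
  Parent-< = proj₁ ∘ childOf-bounds l valid

  Parent-unique : ∀ {x x′ y} → Parent x y → Parent x′ y → x ≡ x′
  Parent-unique e e′ = toℕ-injective (parent-unique l valid e e′)

  parent : ∀ (i : Fin (length l)) → ∃ λ x → Parent x (suc i)
  parent i with x , e ← parent-exists l (toℕ i) (toℕ<n i) =
    fromℕ< x< , subst (λ u → childOf l u (suc (toℕ i)) ≡ true) (≡-sym (toℕ-fromℕ< x<)) e
    where
    x< : x < suc (length l)
    x< = <-trans (proj₁ (childOf-bounds l valid e)) (toℕ<n (suc i))

  degree-bound : ∀ x → degree T x ≤ suc (children (toℕ x) l)
  degree-bound x = begin
    degree T x                 ≤⟨ countF-∪ below above ⟩
    countF below + countF above ≤⟨ +-mono-≤ (count-children {suc (length l)} l (toℕ x)) (countF-≤1 above λ i j → Parent-unique) ⟩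
    children (toℕ x) l + 1     ≡⟨ +-comm _ 1 ⟩
    suc (children (toℕ x) l) ∎
    where
    open ≤-Reasoning
    below above : Node → Bool
    below y = childOf l (toℕ x) (toℕ y)
    above y = childOf l (toℕ y) (toℕ x)

  private
    Walk : Node → Node → Set
    Walk = WalkIn T (λ _ → Node)

  -- The number `m` bounds the label of `x`; it decreases because parents have smaller labels.
  fromRoot : ∀ m x → toℕ x ≤ m → ∀ {z} → Walk x z → Walk zero z
  fromRoot m       zero    _        w = w
  fromRoot (suc m) (suc i) (s≤s i≤) w with x , e ← parent i =
    fromRoot m x (≤-trans (s≤s⁻¹ (Parent-< e)) i≤) (step x (edge⁺ e) w)

  toRoot : ∀ m x → toℕ x ≤ m → ∀ {z} → Walk zero z → Walk x z
  toRoot m       zero    _        w = w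
  toRoot (suc m) (suc i) (s≤s i≤) w with x , e ← parent i =
    step x (edge⁺′ e) (toRoot m x (≤-trans (s≤s⁻¹ (Parent-< e)) i≤) w)

  connected : Connected T
  connected x y _ _ = toRoot _ x ≤-refl (fromRoot _ y ≤-refl (here y))

  -- A simple path that has once moved to a child can never move back to a parent.
  descend : ∀ {w a z} ys → Parent w a → Linked (Edge T) (a ∷ ys ++ [ z ]) →
    Unique (w ∷ a ∷ ys ++ [ z ]) → toℕ a < toℕ z × ∃ λ u → u ∈ a ∷ ys × Parent u z
  descend [] wa (e ∷ _) ((_ ∷ w≢z ∷ []) ∷ _) with edge⁻ e
  ... | inj₁ az = Parent-< az , _ , here refl , az
  ... | inj₂ za = ⊥-elim (w≢z (Parent-unique wa za))
  descend (y ∷ ys) wa (e ∷ lk) ((_ ∷ w≢y ∷ _) ∷ u) with edge⁻ e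
  ... | inj₂ ya = ⊥-elim (w≢y (Parent-unique wa ya))
  ... | inj₁ ay with y<z , v , v∈ , vz ← descend ys ay lk u =
    <-trans (Parent-< ay) y<z , v , there v∈ , vz

  -- The path either climbs all the way, so that labels keep falling, or turns downwards once, after
  -- which `descend` applies.
  ascend : ∀ {w a z} ys → Parent a w → Linked (Edge T) (a ∷ ys ++ [ z ]) →
    Unique (w ∷ a ∷ ys ++ [ z ]) → toℕ z < toℕ w ⊎ ∃ λ u → u ∈ a ∷ ys × Parent u z
  ascend [] aw (e ∷ _) _ with edge⁻ e
  ... | inj₁ az = inj₂ (_ , here refl , az)
  ... | inj₂ za = inj₁ (<-trans (Parent-< za) (Parent-< aw))
  ascend (y ∷ ys) aw (e ∷ lk) (_ ∷ u) with edge⁻ e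
  ... | inj₁ ay with _ , v , v∈ , vz ← descend ys ay lk u = inj₂ (v , there v∈ , vz)
  ... | inj₂ ya with ascend ys ya lk u
  ...   | inj₁ z<a            = inj₁ (<-trans z<a (Parent-< aw))
  ...   | inj₂ (v , v∈ , vz) = inj₂ (v , there v∈ , vz)

  distinct-from-head : ∀ {x z : Node} ys → Unique (x ∷ ys ++ [ z ]) → x ∉ ys
  distinct-from-head ys (x≢ ∷ _) x∈ = All.lookup (All.++⁻ˡ ys x≢) x∈ refl

  -- The cases are the directions of the two cycle edges at `x`. In each, either the labels
  -- contradict each other around the cycle or some node has two distinct parents on it.
  acyclic : ¬ HasCycle T
  acyclic (x , y ∷ ys , z , _ , u@(_ ∷ (y≢ ∷ _)) , e ∷ lk , zx) with edge⁻ e | edge⁻ zx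
  ... | inj₁ xy | inj₁ zx′ =
    <-asym (<-trans (Parent-< zx′) (Parent-< xy)) (proj₁ (descend ys xy lk u))
  ... | inj₁ xy | inj₂ xz with _ , v , v∈ , vz ← descend ys xy lk u
                          with refl ← Parent-unique xz vz = distinct-from-head (y ∷ ys) u v∈
  ... | inj₂ yx | inj₁ zx′ = All.head (All.++⁻ʳ ys y≢) (Parent-unique yx zx′)
  ... | inj₂ yx | inj₂ xz with ascend ys yx lk u
  ...   | inj₁ z<x = <-asym z<x (Parent-< xz)
  ...   | inj₂ (v , v∈ , vz) with refl ← Parent-unique xz vz = distinct-from-head (y ∷ ys) u v∈

  isTree : IsTree T
  isTree = s≤s z≤n , connected , acyclic

-- From parent lists to tree-partitions

Joined : List ℕ → ℕ → ℕ → Set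
Joined l i j = i ≡ j ⊎ childOf l i j ≡ true ⊎ childOf l j i ≡ true

Joined-sym : ∀ {l i j} → Joined l i j → Joined l j i
Joined-sym (inj₁ i≡j)     = inj₁ (≡-sym i≡j)
Joined-sym (inj₂ (inj₁ c)) = inj₂ (inj₂ c)
Joined-sym (inj₂ (inj₂ c)) = inj₂ (inj₁ c)

fromParentList : ∀ G l → Valid l → (f : Vtx G → ℕ) → (∀ v → f v ≤ length l) → ∀ Δ w →
  (∀ x → suc (children x l) ≤ Δ) → (∀ x → countF (λ v → ⌊ f v ≟ℕ x ⌋) ≤ w) →
  (∀ v u → Edge G v u → Joined l (f v) (f u)) →
  Σ Graph λ T → Σ (Vtx G → Vtx T) λ f → IsTree T × maxDegree T ≤ Δ × IsTPartition G T f × partWidth G T f ≤ w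
fromParentList G l valid f f≤ Δ w deg wid joined =
  T , g , isTree , maxF-lub (λ x → ≤-trans (degree-bound x) (deg (toℕ x))) , partition ,
  maxF-lub λ x → ≤-trans (countF-mono (part⊆ x)) (wid (toℕ x))
  where
  open ParentTree l valid
  g : Vtx G → Node
  g v = fromℕ< (s≤s (f≤ v))
  toℕ-g : ∀ v → toℕ (g v) ≡ f v
  toℕ-g v = toℕ-fromℕ< (s≤s (f≤ v))
  partition : IsTPartition G T g
  partition v u e with joined v u e
  ... | inj₁ f≡ = inj₁ (toℕ-injective (trans (toℕ-g v) (trans f≡ (≡-sym (toℕ-g u)))))
  ... | inj₂ (inj₁ c) rewrite toℕ-g v | toℕ-g u = inj₂ (∨⁺ˡ c)
  ... | inj₂ (inj₂ c) rewrite toℕ-g v | toℕ-g u = inj₂ (∨⁺ʳ {childOf l (f v) (f u)} c)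
  part⊆ : ∀ x → (λ v → ⌊ g v ≟ x ⌋) ⊆ (λ v → ⌊ f v ≟ℕ toℕ x ⌋)
  part⊆ x v e = ⌊⌋⁺ (f v ≟ℕ toℕ x) (trans (≡-sym (toℕ-g v)) (cong toℕ (⌊⌋⁻ (g v ≟ x) e)))

-- The tree-partition

-- The hypothesis w-eq says w = 2K(9Δ − 1) without subtraction.
module Construction (G : Graph) (D : TreeDecomposition G) (K : ℕ)
  (bag≤K : ∀ t → countF (TreeDecomposition.bag D t) ≤ K) (0<K : 0 < K) (0<Δ : 0 < maxDegree G)
  (w : ℕ) (w-eq : w + 2 * K ≡ 18 * (K * maxDegree G)) where

  Δ : ℕ
  Δ = maxDegree G

  -- The tree l built so far is extended below its node r; nodes above length l are new.
  -- Threading l through both sides of a separation identifies their roots at no cost.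
  record Extension (U S : Vtx G → Bool) (l : List ℕ) (r : ℕ) : Set where
    field
      l′  : List ℕ
      f   : Vtx G → ℕ
      valid  : Valid l′
      longer : length l ≤ length l′
      mono   : ∀ {i j} → childOf l i j ≡ true → childOf l′ i j ≡ true
      S-root : ∀ v → S v ≡ true → f v ≡ r
      placed : ∀ v → U v ≡ true → f v ≡ r ⊎ (length l < f v × f v ≤ length l′)
      joined : ∀ v u → U v ≡ true → U u ≡ true → Edge G v u → Joined l′ (f v) (f u)
      children-old  : ∀ x → x ≤ length l → x ≢ r → children x l′ ≡ children x l
      -- Only children added by this extension are charged to `S`, since `r` may already have
      -- children in `l` from the other side of a separation.
      children-root : 2 * K * suc (children r l′) ≤ countF S + 2 * K * children r l
      children-new  : ∀ x → length l < x → suc (children x l′) ≤ 6 * Δ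
      width-root    : 2 * countF (U ∩ preimage f r) + 4 * K ≤ 3 * countF S
      width-new     : ∀ x → length l < x → countF (U ∩ preimage f x) ≤ w

  preimage⁻ : ∀ {U : Vtx G → Bool} {f : Vtx G → ℕ} {x v} → (U ∩ preimage f x) v ≡ true → U v ≡ true × f v ≡ x
  preimage⁻ {U} {f} {x} {v} e with a , b ← ∧⁻ {U v} e = a , ⌊⌋⁻ (f v ≟ℕ x) b

  -- Arithmetic of the constants

  K≤K*Δ : K ≤ K * Δ
  K≤K*Δ = ≤-trans (≤-reflexive (≡-sym (*-identityʳ K))) (*-monoʳ-≤ K 0<Δ)

  0<6Δ : 1 ≤ 6 * Δ
  0<6Δ = ≤-trans 0<Δ (m≤m+n Δ _)

  4K≤w : 4 * K ≤ w
  4K≤w = +-cancelʳ-≤ (2 * K) _ _ (begin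
    4 * K + 2 * K ≡⟨ eq K ⟩
    6 * K         ≤⟨ *-mono-≤ {6} {18} (m≤m+n 6 12) K≤K*Δ ⟩
    18 * (K * Δ)  ≡⟨ w-eq ⟨
    w + 2 * K     ∎)
    where
    open ≤-Reasoning
    eq : ∀ k → 4 * k + 2 * k ≡ 6 * k
    eq = solve-∀

  -- The root invariant at the largest admissible |S|: half of 36KΔ - 4K is exactly `w`.
  half-width : ∀ {x s} → 2 * x + 4 * K ≤ 3 * s → s ≤ 12 * (K * Δ) → x ≤ w
  half-width {x} {s} h s≤ = *-cancelˡ-≤ 2 (+-cancelʳ-≤ (4 * K) _ _ (begin
    2 * x + 4 * K        ≤⟨ h ⟩
    3 * s                ≤⟨ *-monoʳ-≤ 3 s≤ ⟩
    3 * (12 * (K * Δ))   ≡⟨ eq₁ (K * Δ) ⟩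
    2 * (18 * (K * Δ))   ≡⟨ cong (2 *_) w-eq ⟨
    2 * (w + 2 * K)      ≡⟨ eq₂ w K ⟩
    2 * w + 4 * K        ∎))
    where
    open ≤-Reasoning
    eq₁ : ∀ z → 3 * (12 * z) ≡ 2 * (18 * z)
    eq₁ = solve-∀
    eq₂ : ∀ a b → 2 * (a + 2 * b) ≡ 2 * a + 4 * b
    eq₂ = solve-∀

  -- 12KΔ divided by 2K is 6Δ; the `suc` is the place reserved for the parent.
  root-degree : ∀ {c s} → 2 * K * suc c ≤ s → s ≤ 12 * (K * Δ) → suc c ≤ 6 * Δ
  root-degree {c} {s} h s≤ = *-cancelˡ-≤ (2 * K) (begin
    2 * K * suc c    ≤⟨ h ⟩
    s                ≤⟨ s≤ ⟩
    12 * (K * Δ)     ≡⟨ eq K Δ ⟩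
    2 * K * (6 * Δ)  ∎)
    where
    open ≤-Reasoning
    instance 2K≢0 = >-nonZero (≤-trans 0<K (m≤m+n K _))
    eq : ∀ a b → 12 * (a * b) ≡ 2 * a * (6 * b)
    eq = solve-∀

  one-child : ∀ {s} c → 4 * K ≤ s → 2 * K * suc (suc c) ≤ s + 2 * K * c
  one-child {s} c 4K≤ = begin
    2 * K * suc (suc c)   ≡⟨ eq K c ⟩
    4 * K + 2 * K * c     ≤⟨ +-monoˡ-≤ _ 4K≤ ⟩
    s + 2 * K * c         ∎
    where
    open ≤-Reasoning
    eq : ∀ a b → 2 * a * (2 + b) ≡ 4 * a + 2 * a * b
    eq = solve-∀

  root-only : ∀ {x s} → x ≤ s → 4 * K ≤ s → 2 * x + 4 * K ≤ 3 * s
  root-only {x} {s} x≤s 4K≤ = begin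
    2 * x + 4 * K ≤⟨ +-mono-≤ (*-monoʳ-≤ 2 x≤s) 4K≤ ⟩
    2 * s + s     ≡⟨ eq s ⟩
    3 * s         ∎
    where
    open ≤-Reasoning
    eq : ∀ z → 2 * z + z ≡ 3 * z
    eq = solve-∀

  -- The three ways to extend a tree

  module _ {U S : Vtx G → Bool} {l : List ℕ} {r : ℕ} (S⊆U : S ⊆ U) (4K≤S : 4 * K ≤ countF S)
    (valid : Valid l) (r≤ : r ≤ length l) where

    private
      new : ℕ
      new = suc (length l)
      old≢new : ∀ {x y} → x ≤ length l → length l < y → x ≢ y
      old≢new x≤ <y refl = <-irrefl refl (≤-trans <y x≤)
      r≢new : r ≢ new
      r≢new = old≢new r≤ ≤-refl
      root-children : ∀ l′ → children r l′ ≡ children r (r ∷ l) →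
        2 * K * suc (children r l′) ≤ countF S + 2 * K * children r l
      root-children l′ e rewrite e | children-≡ r l = one-child (children r l) 4K≤S

    extend-by-leaf : countF (U ∖ S) ≤ w → Extension U S l r
    extend-by-leaf U∖S≤w = record
      { l′ = r ∷ l ; f = f ; valid = r≤ , valid ; longer = n≤1+n _
      ; mono = childOf-tail r l
      ; S-root = λ v → if-true
      ; placed = placed
      ; joined = joined
      ; children-old = λ x _ x≢r → children-≢ l x≢r
      ; children-root = root-children (r ∷ l) refl
      ; children-new = λ x len< → subst (λ c → suc c ≤ 6 * Δ)
          (≡-sym (trans (children-≢ l (old≢new r≤ len< ∘ ≡-sym)) (children-fresh l valid len<))) 0<6Δ
      ; width-root = root-only (countF-mono root⊆S) 4K≤S
      ; width-new = λ x len< → ≤-trans (countF-mono (new⊆ len<)) U∖S≤w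
      }
      where
      f : Vtx G → ℕ
      f v = if S v then r else new
      placed : ∀ v → U v ≡ true → f v ≡ r ⊎ (length l < f v × f v ≤ new)
      placed v _ with S v
      ... | true  = inj₁ refl
      ... | false = inj₂ (≤-refl , ≤-refl)
      joined : ∀ v u → U v ≡ true → U u ≡ true → Edge G v u → Joined (r ∷ l) (f v) (f u)
      joined v u _ _ _ with S v | S u
      ... | true  | true  = inj₁ refl
      ... | true  | false = inj₂ (inj₁ (childOf-head r l))
      ... | false | true  = inj₂ (inj₂ (childOf-head r l))
      ... | false | false = inj₁ refl
      root⊆S : (U ∩ preimage f r) ⊆ S
      root⊆S v e with _ , fv≡r ← preimage⁻ {U} {f} e with bool-cases (S v)
      ... | inj₁ Sv = Sv
      ... | inj₂ ¬S = ⊥-elim (r≢new (trans (≡-sym fv≡r) (if-false ¬S)))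
      new⊆ : ∀ {x} → length l < x → (U ∩ preimage f x) ⊆ (U ∖ S)
      new⊆ len< v e with Uv , fv≡x ← preimage⁻ {U} {f} e with bool-cases (S v)
      ... | inj₁ Sv = ⊥-elim (old≢new r≤ len< (trans (≡-sym (if-true Sv)) fv≡x))
      ... | inj₂ ¬S = ∧⁺ Uv (not⁺ ¬S)

    -- Every edge from `S` to the rest of `U` ends in `S′`, hence in the part at `new`. The root of
    -- the inner extension becomes an ordinary node here, so its two root bounds are converted by
    -- `root-degree` and `half-width`.
    extend-by-layer : ∀ {S′} → (neighbours G S ∩ (U ∖ S)) ⊆ S′ → countF S′ ≤ 12 * (K * Δ) →
      Extension (U ∖ S) S′ (r ∷ l) new → Extension U S l r
    extend-by-layer {S′} N⊆S′ S′≤ E = record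
      { l′ = E.l′ ; f = f ; valid = E.valid ; longer = <⇒≤ E.longer
      ; mono = E.mono ∘ childOf-tail r l
      ; S-root = λ v → if-true
      ; placed = placed
      ; joined = joined
      ; children-old = λ x x≤ x≢r →
          trans (E.children-old x (m≤n⇒m≤1+n x≤) (old≢new x≤ ≤-refl)) (children-≢ l x≢r)
      ; children-root = root-children E.l′ (E.children-old r (m≤n⇒m≤1+n r≤) r≢new)
      ; children-new = children-new
      ; width-root = root-only (countF-mono root⊆S) 4K≤S
      ; width-new = width-new
      }
      where
      module E = Extension E
      f : Vtx G → ℕ
      f v = if S v then r else E.f v
      outside : ∀ {v} → U v ≡ true → S v ≡ false → length l < E.f v × E.f v ≤ length E.l′
      outside {v} Uv ¬S with E.placed v (∧⁺ Uv (not⁺ ¬S))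
      ... | inj₁ e rewrite e     = ≤-refl , E.longer
      ... | inj₂ (len< , ≤len) = <⇒≤ len< , ≤len
      placed : ∀ v → U v ≡ true → f v ≡ r ⊎ (length l < f v × f v ≤ length E.l′)
      placed v Uv with S v in eq
      ... | true  = inj₁ refl
      ... | false = inj₂ (outside Uv eq)
      cross : ∀ {v u} → S v ≡ true → S u ≡ false → U u ≡ true → Edge G v u → Joined E.l′ r (E.f u)
      cross {v} {u} Sv ¬S Uu e
        rewrite E.S-root u (N⊆S′ u (∧⁺ (neighbours⁺ G S Sv e) (∧⁺ Uu (not⁺ ¬S)))) =
        inj₂ (inj₁ (E.mono (childOf-head r l)))
      joined : ∀ v u → U v ≡ true → U u ≡ true → Edge G v u → Joined E.l′ (f v) (f u)
      joined v u Uv Uu e with S v in ev | S u in eu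
      ... | true  | true  = inj₁ refl
      ... | true  | false = cross ev eu Uu e
      ... | false | true  = Joined-sym {E.l′} (cross eu ev Uv (trans (sym G u v) e))
      ... | false | false = E.joined v u (∧⁺ Uv (not⁺ ev)) (∧⁺ Uu (not⁺ eu)) e
      root⊆S : (U ∩ preimage f r) ⊆ S
      root⊆S v e with Uv , fv≡r ← preimage⁻ {U} {f} e with bool-cases (S v)
      ... | inj₁ Sv = Sv
      ... | inj₂ ¬S = ⊥-elim (old≢new r≤ (proj₁ (outside Uv ¬S)) (trans (≡-sym fv≡r) (if-false ¬S)))
      new⊆ : ∀ {x} → length l < x → (U ∩ preimage f x) ⊆ ((U ∖ S) ∩ preimage E.f x)
      new⊆ {x} len< v e with Uv , fv≡x ← preimage⁻ {U} {f} e with bool-cases (S v)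
      ... | inj₁ Sv = ⊥-elim (old≢new r≤ len< (trans (≡-sym (if-true Sv)) fv≡x))
      ... | inj₂ ¬S = ∧⁺ (∧⁺ Uv (not⁺ ¬S)) (⌊⌋⁺ (E.f v ≟ℕ x) (trans (≡-sym (if-false ¬S)) fv≡x))
      new-childless : children new (r ∷ l) ≡ 0
      new-childless = trans (children-≢ l (r≢new ∘ ≡-sym)) (children-fresh l valid ≤-refl)
      children-new : ∀ x → length l < x → suc (children x E.l′) ≤ 6 * Δ
      children-new x len< with m≤n⇒m<n∨m≡n len<
      ... | inj₁ new<x = E.children-new x new<x
      ... | inj₂ refl  = root-degree (subst (2 * K * suc (children new E.l′) ≤_) no-children E.children-root) S′≤
        where
        no-children : countF S′ + 2 * K * children new (r ∷ l) ≡ countF S′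
        no-children rewrite new-childless | *-zeroʳ (2 * K) = +-identityʳ _
      width-new : ∀ x → length l < x → countF (U ∩ preimage f x) ≤ w
      width-new x len< with m≤n⇒m<n∨m≡n len<
      ... | inj₁ new<x = ≤-trans (countF-mono (new⊆ len<)) (E.width-new x new<x)
      ... | inj₂ refl  = ≤-trans (countF-mono (new⊆ len<)) (half-width E.width-root S′≤)

    module Separated (separation : BalancedSeparation G K S) (12K<S : 12 * K < countF S) where
      open BalancedSeparation separation

      -- Putting `A ∩ U` into both root sets forces the two placements to agree on it. Vertices of S
      -- ∩ A are left out of `rest` because `A ∩ U` already supplies them.
      rest U₁ U₂ S₁ S₂ : Vtx G → Bool
      rest = S ∖ X ∖ A
      U₁ = U ∩ (X ∪ A)
      U₂ = U ∖ X
      S₁ = (S ∩ X) ∪ (A ∩ U)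
      S₂ = rest ∪ (A ∩ U)

      s = countF S
      a = countF (A ∩ U)

      a≤K : a ≤ K
      a≤K = ≤-trans (countF-mono {p = A ∩ U} {A} (λ v e → proj₁ (∧⁻ e))) A-small

      parts≤s : countF (S ∩ X) + countF rest ≤ s
      parts≤s = countF-+-≤ (S ∩ X) rest S λ v → pw (S v) (X v) (A v)
        where
        pw : ∀ s x a → 𝟙 (s ∧ x) + 𝟙 ((s ∧ not x) ∧ not a) ≤ 𝟙 s
        pw false x     a     = z≤n
        pw true  true  a     = ≤-refl
        pw true  false true  = z≤n
        pw true  false false = ≤-refl

      S₁≤ : countF S₁ ≤ countF (S ∩ X) + a
      S₁≤ = countF-∪ (S ∩ X) (A ∩ U)

      S₂≤ : countF S₂ ≤ countF rest + a
      S₂≤ = countF-∪ rest (A ∩ U)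

      s≤S₁ : s ≤ countF S₁ + countF rest
      s≤S₁ = countF-≤-+ S S₁ rest λ v → pw (S v) (X v) (A v) (U v) (S⊆U v)
        where
        pw : ∀ s x a u → (s ≡ true → u ≡ true) → 𝟙 s ≤ 𝟙 ((s ∧ x) ∨ (a ∧ u)) + 𝟙 ((s ∧ not x) ∧ not a)
        pw false x     a     u     h = z≤n
        pw true  true  a     u     h = s≤s z≤n
        pw true  false false u     h = ≤-refl
        pw true  false true  true  h = s≤s z≤n
        pw true  false true  false h with () ← h refl

      s≤S₂ : s ≤ countF S₂ + countF (S ∩ X)
      s≤S₂ = countF-≤-+ S S₂ (S ∩ X) λ v → pw (S v) (X v) (A v) (U v) (S⊆U v)
        where
        pw : ∀ s x a u → (s ≡ true → u ≡ true) → 𝟙 s ≤ 𝟙 (((s ∧ not x) ∧ not a) ∨ (a ∧ u)) + 𝟙 (s ∧ x)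
        pw false x     a     u     h = z≤n
        pw true  true  a     u     h = m≤n+m 1 _
        pw true  false false u     h = s≤s z≤n
        pw true  false true  true  h = s≤s z≤n
        pw true  false true  false h with () ← h refl

      -- The other side accounts for at most two thirds of `S`, so this one has at least a third of
      -- more than 12K vertices.
      large-side : ∀ {x y} → s ≤ x + y → 3 * y ≤ 2 * s → 4 * K ≤ x
      large-side {x} {y} s≤ y≤ = *-cancelˡ-≤ 3 (begin
        3 * (4 * K) ≡⟨ eq K ⟩
        12 * K      ≤⟨ <⇒≤ 12K<S ⟩
        s           ≤⟨ +-cancelʳ-≤ (2 * s) _ _ (begin
          s + 2 * s     ≤⟨ *-monoʳ-≤ 3 s≤ ⟩
          3 * (x + y)   ≡⟨ *-distribˡ-+ 3 x y ⟩
          3 * x + 3 * y ≤⟨ +-monoʳ-≤ (3 * x) y≤ ⟩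
          3 * x + 2 * s ∎) ⟩
        3 * x       ∎)
        where
        open ≤-Reasoning
        eq : ∀ k → 3 * (4 * k) ≡ 12 * k
        eq = solve-∀

      small-side : ∀ {x y} → y ≤ x + a → 3 * x ≤ 2 * s → y < s
      small-side {x} {y} y≤ x≤ = *-cancelˡ-< 3 _ _ (begin-strict
        3 * y         ≤⟨ *-monoʳ-≤ 3 y≤ ⟩
        3 * (x + a)   ≡⟨ *-distribˡ-+ 3 x a ⟩
        3 * x + 3 * a ≤⟨ +-mono-≤ x≤ (*-mono-≤ {3} {12} (m≤m+n 3 9) a≤K) ⟩
        2 * s + 12 * K <⟨ +-monoʳ-< (2 * s) 12K<S ⟩
        2 * s + s     ≡⟨ +-comm (2 * s) s ⟩
        3 * s         ∎)
        where open ≤-Reasoning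

      S₁<s : countF S₁ < s
      S₁<s = small-side S₁≤ X-light

      S₂<s : countF S₂ < s
      S₂<s = small-side S₂≤ rest-light

      -- The set `rest` is lost from `U`. It is non-empty, since together with `S₁` it covers `S`,
      -- while `S₁` is smaller than `S`.
      U₁<U : countF U₁ < countF U
      U₁<U = +-cancelʳ-< (countF rest) _ _ (begin-strict
        countF U₁ + countF rest ≤⟨ countF-+-≤ U₁ rest U (λ v → pw (S v) (X v) (A v) (U v) (S⊆U v)) ⟩
        countF U                ≡⟨ +-identityʳ _ ⟨
        countF U + 0            <⟨ +-monoʳ-< (countF U) (+-cancelˡ-< (countF S₁) _ _ (begin-strict
          countF S₁ + 0             ≡⟨ +-identityʳ _ ⟩
          countF S₁                 <⟨ S₁<s ⟩
          s                         ≤⟨ s≤S₁ ⟩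
          countF S₁ + countF rest   ∎)) ⟩
        countF U + countF rest  ∎)
        where
        open ≤-Reasoning
        pw : ∀ s x a u → (s ≡ true → u ≡ true) → 𝟙 (u ∧ (x ∨ a)) + 𝟙 ((s ∧ not x) ∧ not a) ≤ 𝟙 u
        pw false x     a     false h = z≤n
        pw false true  a     true  h = ≤-refl
        pw false false true  true  h = ≤-refl
        pw false false false true  h = z≤n
        pw true  x     a     false h with () ← h refl
        pw true  true  a     true  h = ≤-refl
        pw true  false true  true  h = ≤-refl
        pw true  false false true  h = ≤-refl

      U₂<U : countF U₂ < countF U
      U₂<U = +-cancelʳ-< (countF (S ∩ X)) _ _ (begin-strict
        countF U₂ + countF (S ∩ X) ≤⟨ countF-+-≤ U₂ (S ∩ X) U (λ v → pw (S v) (X v) (U v) (S⊆U v)) ⟩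
        countF U                ≡⟨ +-identityʳ _ ⟨
        countF U + 0            <⟨ +-monoʳ-< (countF U) (+-cancelˡ-< (countF S₂) _ _ (begin-strict
          countF S₂ + 0             ≡⟨ +-identityʳ _ ⟩
          countF S₂                 <⟨ S₂<s ⟩
          s                         ≤⟨ s≤S₂ ⟩
          countF S₂ + countF (S ∩ X) ∎)) ⟩
        countF U + countF (S ∩ X)  ∎)
        where
        open ≤-Reasoning
        pw : ∀ s x u → (s ≡ true → u ≡ true) → 𝟙 (u ∧ not x) + 𝟙 (s ∧ x) ≤ 𝟙 u
        pw false true  false h = z≤n
        pw false false false h = z≤n
        pw false true  true  h = z≤n
        pw false false true  h = ≤-refl
        pw true  x     false h with () ← h refl
        pw true  true  true  h = ≤-refl
        pw true  false true  h = ≤-refl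

      S₁⊆U₁ : S₁ ⊆ U₁
      S₁⊆U₁ v e with ∨⁻ {S v ∧ X v} e
      ... | inj₁ e′ with Sv , Xv ← ∧⁻ e′ = ∧⁺ (S⊆U v Sv) (∨⁺ˡ Xv)
      ... | inj₂ e′ with Av , Uv ← ∧⁻ e′ = ∧⁺ Uv (∨⁺ʳ {X v} Av)

      A⇒¬X : ∀ {v} → A v ≡ true → X v ≡ false
      A⇒¬X Av = ¬true⇒false λ Xv → true≢false Av (disjoint _ Xv)

      S₂⊆U₂ : S₂ ⊆ U₂
      S₂⊆U₂ v e with ∨⁻ {rest v} e
      ... | inj₁ e′ with SX , _ ← ∧⁻ {S v ∧ not (X v)} e′ with Sv , ¬X ← ∧⁻ {S v} SX = ∧⁺ (S⊆U v Sv) ¬X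
      ... | inj₂ e′ with Av , Uv ← ∧⁻ e′ = ∧⁺ Uv (not⁺ (A⇒¬X Av))

      S₁+S₂≤ : countF S₁ + countF S₂ ≤ s + 2 * a
      S₁+S₂≤ = begin
        countF S₁ + countF S₂ ≤⟨ +-mono-≤ S₁≤ S₂≤ ⟩
        countF (S ∩ X) + a + (countF rest + a) ≡⟨ eq (countF (S ∩ X)) a (countF rest) ⟩
        countF (S ∩ X) + countF rest + 2 * a ≤⟨ +-monoˡ-≤ (2 * a) parts≤s ⟩
        s + 2 * a ∎
        where
        open ≤-Reasoning
        eq : ∀ x y z → x + y + (z + y) ≡ x + z + 2 * y
        eq = solve-∀

      glue : (E₁ : Extension U₁ S₁ l r) → Extension U₂ S₂ (Extension.l′ E₁) r → Extension U S l r
      glue E₁ E₂ = record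
        { l′ = E₂.l′ ; f = f ; valid = E₂.valid
        ; longer = ≤-trans E₁.longer E₂.longer
        ; mono = E₂.mono ∘ E₁.mono
        ; S-root = S-root
        ; placed = placed
        ; joined = joined
        ; children-old = λ x x≤ x≢r → trans (E₂.children-old x (≤-trans x≤ E₁.longer) x≢r) (E₁.children-old x x≤ x≢r)
        ; children-root = children-root
        ; children-new = children-new
        ; width-root = width-root
        ; width-new = width-new
        }
        where
        module E₁ = Extension E₁
        module E₂ = Extension E₂

        f : Vtx G → ℕ
        f v = if X v then E₁.f v else E₂.f v

        f₁-A : ∀ {v} → A v ≡ true → U v ≡ true → E₁.f v ≡ r
        f₁-A {v} Av Uv = E₁.S-root v (∨⁺ʳ {S v ∧ X v} (∧⁺ Av Uv))

        f₂-A : ∀ {v} → A v ≡ true → U v ≡ true → E₂.f v ≡ r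
        f₂-A {v} Av Uv = E₂.S-root v (∨⁺ʳ {rest v} (∧⁺ Av Uv))

        f≡f₁ : ∀ {v} → U₁ v ≡ true → f v ≡ E₁.f v
        f≡f₁ {v} e with Uv , XA ← ∧⁻ {U v} e with ∨⁻ {X v} XA
        ... | inj₁ Xv = if-true Xv
        ... | inj₂ Av = trans (if-false (A⇒¬X Av)) (trans (f₂-A Av Uv) (≡-sym (f₁-A Av Uv)))

        f≡f₂ : ∀ {v} → U₂ v ≡ true → f v ≡ E₂.f v
        f≡f₂ {v} e = if-false (not⁻ (proj₂ (∧⁻ {U v} e)))

        side : ∀ {v} → U v ≡ true → U₁ v ≡ true ⊎ U₂ v ≡ true
        side {v} Uv with bool-cases (X v)
        ... | inj₁ Xv = inj₁ (∧⁺ Uv (∨⁺ˡ Xv))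
        ... | inj₂ ¬X = inj₂ (∧⁺ Uv (not⁺ ¬X))

        S-root : ∀ v → S v ≡ true → f v ≡ r
        S-root v Sv with bool-cases (X v) | bool-cases (A v)
        ... | inj₁ Xv | _       = trans (if-true Xv) (E₁.S-root v (∨⁺ˡ (∧⁺ Sv Xv)))
        ... | inj₂ ¬X | inj₁ Av = trans (if-false ¬X) (f₂-A Av (S⊆U v Sv))
        ... | inj₂ ¬X | inj₂ ¬A = trans (if-false ¬X) (E₂.S-root v (∨⁺ˡ (∧⁺ (∧⁺ Sv (not⁺ ¬X)) (not⁺ ¬A))))

        placed : ∀ v → U v ≡ true → f v ≡ r ⊎ (length l < f v × f v ≤ length E₂.l′)
        placed v Uv with side Uv
        ... | inj₁ U₁v rewrite f≡f₁ U₁v with E₁.placed v U₁v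
        ...   | inj₁ e            = inj₁ e
        ...   | inj₂ (len< , ≤len) = inj₂ (len< , ≤-trans ≤len E₂.longer)
        placed v Uv | inj₂ U₂v rewrite f≡f₂ U₂v with E₂.placed v U₂v
        ...   | inj₁ e            = inj₁ e
        ...   | inj₂ (len< , ≤len) = inj₂ (≤-trans (s≤s E₁.longer) len< , ≤len)

        Joined-mono : ∀ {i j} → Joined E₁.l′ i j → Joined E₂.l′ i j
        Joined-mono (inj₁ i≡j)      = inj₁ i≡j
        Joined-mono (inj₂ (inj₁ c)) = inj₂ (inj₁ (E₂.mono c))
        Joined-mono (inj₂ (inj₂ c)) = inj₂ (inj₂ (E₂.mono c))

        joined₁ : ∀ {v u} → U₁ v ≡ true → U₁ u ≡ true → Edge G v u → Joined E₂.l′ (f v) (f u)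
        joined₁ {v} {u} U₁v U₁u e =
          subst₂ (Joined E₂.l′) (≡-sym (f≡f₁ U₁v)) (≡-sym (f≡f₁ U₁u)) (Joined-mono (E₁.joined v u U₁v U₁u e))

        neighbour-side : ∀ {v u} → X v ≡ true → U u ≡ true → Edge G v u → U₁ u ≡ true
        neighbour-side {u = u} Xv Uu e with closed _ _ Xv e
        ... | inj₁ Xu = ∧⁺ Uu (∨⁺ˡ Xu)
        ... | inj₂ Au = ∧⁺ Uu (∨⁺ʳ {X u} Au)

        joined : ∀ v u → U v ≡ true → U u ≡ true → Edge G v u → Joined E₂.l′ (f v) (f u)
        -- By `closed`, an edge with an end in `X` lies inside `U₁`; any other edge of `U` lies
        -- inside `U₂`.
        joined v u Uv Uu e with bool-cases (X v) | bool-cases (X u)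
        ... | inj₁ Xv | _       = joined₁ (∧⁺ Uv (∨⁺ˡ Xv)) (neighbour-side Xv Uu e) e
        ... | inj₂ ¬X | inj₁ Xu =
          joined₁ (neighbour-side Xu Uv (trans (sym G u v) e)) (∧⁺ Uu (∨⁺ˡ Xu)) e
        ... | inj₂ ¬Xv | inj₂ ¬Xu = subst₂ (Joined E₂.l′) (≡-sym (if-false ¬Xv)) (≡-sym (if-false ¬Xu))
          (E₂.joined v u (∧⁺ Uv (not⁺ ¬Xv)) (∧⁺ Uu (not⁺ ¬Xu)) e)

        -- Each side contributes a slack of 2K. One is kept, and the other absorbs the excess 2a ≤
        -- 2K of |S₁| + |S₂| over |S|.
        children-root : 2 * K * suc (children r E₂.l′) ≤ s + 2 * K * children r l
        children-root = +-cancelʳ-≤ (2 * K + c₁) _ _ (begin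
          2 * K * suc (children r E₂.l′) + (2 * K + c₁) ≡⟨ cong (2 * K * suc (children r E₂.l′) +_) (eq₁ K (children r E₁.l′)) ⟨
          2 * K * suc (children r E₂.l′) + 2 * K * suc (children r E₁.l′)
            ≤⟨ +-mono-≤ E₂.children-root E₁.children-root ⟩
          countF S₂ + c₁ + (countF S₁ + c)      ≡⟨ eq₂ (countF S₂) c₁ (countF S₁) c ⟩
          countF S₁ + countF S₂ + (c₁ + c)      ≤⟨ +-monoˡ-≤ (c₁ + c) S₁+S₂≤ ⟩
          s + 2 * a + (c₁ + c)                  ≤⟨ +-monoˡ-≤ (c₁ + c) (+-monoʳ-≤ s (*-monoʳ-≤ 2 a≤K)) ⟩
          s + 2 * K + (c₁ + c)                  ≡⟨ eq₃ s K c₁ c ⟩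
          s + c + (2 * K + c₁)                  ∎)
          where
          open ≤-Reasoning
          c  = 2 * K * children r l
          c₁ = 2 * K * children r E₁.l′
          eq₁ : ∀ k x → 2 * k * (1 + x) ≡ 2 * k + 2 * k * x
          eq₁ = solve-∀
          eq₂ : ∀ x y z t → x + y + (z + t) ≡ z + x + (y + t)
          eq₂ = solve-∀
          eq₃ : ∀ x k y z → x + 2 * k + (y + z) ≡ x + z + (2 * k + y)
          eq₃ = solve-∀

        children-new : ∀ x → length l < x → suc (children x E₂.l′) ≤ 6 * Δ
        children-new x len< with x ≤? length E₁.l′
        ... | no x≰ = E₂.children-new x (≰⇒> x≰)
        ... | yes x≤ = subst (λ c → suc c ≤ 6 * Δ)
          (≡-sym (E₂.children-old x x≤ (old≢new r≤ len< ∘ ≡-sym))) (E₁.children-new x len<)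

        R R₁ R₂ : ℕ
        R  = countF (U ∩ preimage f r)
        R₁ = countF (U₁ ∩ preimage E₁.f r)
        R₂ = countF (U₂ ∩ preimage E₂.f r)

        -- The vertices of `A ∩ U` belong to both root parts and merge into one copy.
        R-split : R + a ≤ R₁ + R₂
        R-split = countF-+-≤-+ (U ∩ preimage f r) (A ∩ U) (U₁ ∩ preimage E₁.f r) (U₂ ∩ preimage E₂.f r) pointwise
          where
          pw : ∀ u x a e e₁ e₂ → (x ≡ true → e ≡ e₁) → (x ≡ false → e ≡ e₂) → (x ≡ true → a ≡ false) →
            (a ≡ true → u ≡ true → e₁ ≡ true) → (a ≡ true → u ≡ true → e₂ ≡ true) →
            𝟙 (u ∧ e) + 𝟙 (a ∧ u) ≤ 𝟙 ((u ∧ (x ∨ a)) ∧ e₁) + 𝟙 ((u ∧ not x) ∧ e₂)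
          pw false x true  e e₁ e₂ h₁ h₂ h₃ h₄ h₅ = z≤n
          pw false x false e e₁ e₂ h₁ h₂ h₃ h₄ h₅ = z≤n
          pw true true true e e₁ e₂ h₁ h₂ h₃ h₄ h₅ with () ← h₃ refl
          pw true true false e e₁ e₂ h₁ h₂ h₃ h₄ h₅ rewrite h₁ refl = ≤-refl
          pw true false false e e₁ e₂ h₁ h₂ h₃ h₄ h₅ rewrite h₂ refl = ≤-reflexive (+-identityʳ _)
          pw true false true e e₁ e₂ h₁ h₂ h₃ h₄ h₅ rewrite h₂ refl | h₄ refl refl | h₅ refl refl = ≤-refl
          pointwise : ∀ v → 𝟙 ((U ∩ preimage f r) v) + 𝟙 ((A ∩ U) v) ≤
            𝟙 ((U₁ ∩ preimage E₁.f r) v) + 𝟙 ((U₂ ∩ preimage E₂.f r) v)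
          pointwise v = pw (U v) (X v) (A v) (preimage f r v) (preimage E₁.f r v) (preimage E₂.f r v)
            (λ e → cong (λ z → ⌊ z ≟ℕ r ⌋) (if-true e))
            (λ e → cong (λ z → ⌊ z ≟ℕ r ⌋) (if-false e))
            (disjoint v)
            (λ Av Uv → ⌊⌋⁺ (E₁.f v ≟ℕ r) (f₁-A Av Uv))
            (λ Av Uv → ⌊⌋⁺ (E₂.f v ≟ℕ r) (f₂-A Av Uv))

        -- Adding `A` twice costs 6a on the right and the double count in `R-split` returns 2a; the
        -- remaining 4a is at most the second slack 4K.
        width-root : 2 * R + 4 * K ≤ 3 * s
        width-root = +-cancelʳ-≤ (2 * a + 4 * K) _ _ (begin
          2 * R + 4 * K + (2 * a + 4 * K)            ≡⟨ eq₁ R K a ⟩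
          2 * (R + a) + 8 * K                        ≤⟨ +-monoˡ-≤ (8 * K) (*-monoʳ-≤ 2 R-split) ⟩
          2 * (R₁ + R₂) + 8 * K                      ≡⟨ eq₂ R₁ R₂ K ⟩
          2 * R₁ + 4 * K + (2 * R₂ + 4 * K)          ≤⟨ +-mono-≤ E₁.width-root E₂.width-root ⟩
          3 * countF S₁ + 3 * countF S₂              ≡⟨ *-distribˡ-+ 3 (countF S₁) (countF S₂) ⟨
          3 * (countF S₁ + countF S₂)                ≤⟨ *-monoʳ-≤ 3 S₁+S₂≤ ⟩
          3 * (s + 2 * a)                            ≡⟨ eq₃ s a ⟩
          3 * s + (2 * a + 4 * a)                    ≤⟨ +-monoʳ-≤ (3 * s) (+-monoʳ-≤ (2 * a) (*-monoʳ-≤ 4 a≤K)) ⟩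
          3 * s + (2 * a + 4 * K)                    ∎)
          where
          open ≤-Reasoning
          eq₁ : ∀ x k y → 2 * x + 4 * k + (2 * y + 4 * k) ≡ 2 * (x + y) + 8 * k
          eq₁ = solve-∀
          eq₂ : ∀ x y k → 2 * (x + y) + 8 * k ≡ 2 * x + 4 * k + (2 * y + 4 * k)
          eq₂ = solve-∀
          eq₃ : ∀ x y → 3 * (x + 2 * y) ≡ 3 * x + (2 * y + 4 * y)
          eq₃ = solve-∀

        width-new : ∀ x → length l < x → countF (U ∩ preimage f x) ≤ w
        -- Apart from `r`, the labels up to the length of `E₁.l′` are used only by the first side
        -- and later ones only by the second, so no two such parts merge.
        width-new x len< with x ≤? length E₁.l′
        ... | yes x≤ = ≤-trans (countF-mono ⊆₁) (E₁.width-new x len<)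
          where
          ⊆₁ : (U ∩ preimage f x) ⊆ (U₁ ∩ preimage E₁.f x)
          ⊆₁ v e with Uv , fv≡x ← preimage⁻ {U} {f} e with side Uv
          ... | inj₁ U₁v = ∧⁺ U₁v (⌊⌋⁺ (E₁.f v ≟ℕ x) (trans (≡-sym (f≡f₁ U₁v)) fv≡x))
          ... | inj₂ U₂v with E₂.placed v U₂v | trans (≡-sym (f≡f₂ U₂v)) fv≡x
          ...   | inj₁ fv≡r      | refl = ⊥-elim (old≢new r≤ len< (≡-sym fv≡r))
          ...   | inj₂ (len₁< , _) | refl = ⊥-elim (<-irrefl refl (≤-trans len₁< x≤))
        ... | no x≰ = ≤-trans (countF-mono ⊆₂) (E₂.width-new x (≰⇒> x≰))
          where
          ⊆₂ : (U ∩ preimage f x) ⊆ (U₂ ∩ preimage E₂.f x)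
          ⊆₂ v e with Uv , fv≡x ← preimage⁻ {U} {f} e with side Uv
          ... | inj₂ U₂v = ∧⁺ U₂v (⌊⌋⁺ (E₂.f v ≟ℕ x) (trans (≡-sym (f≡f₂ U₂v)) fv≡x))
          ... | inj₁ U₁v with E₁.placed v U₁v | trans (≡-sym (f≡f₁ U₁v)) fv≡x
          ...   | inj₁ fv≡r      | refl = ⊥-elim (old≢new r≤ len< (≡-sym fv≡r))
          ...   | inj₂ (_ , ≤len₁) | refl = ⊥-elim (x≰ ≤len₁)

      extend-by-separation : countF S ≤ 12 * (K * Δ) →
        (∀ {U′ S′ l} → countF U′ < countF U → S′ ⊆ U′ → 4 * K ≤ countF S′ → countF S′ ≤ 12 * (K * Δ) →
           Valid l → r ≤ length l → Extension U′ S′ l r) →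
        Extension U S l r
      extend-by-separation S≤ extend = glue E₁
          (extend U₂<U S₂⊆U₂ (large-side s≤S₂ X-light) (≤-trans (<⇒≤ S₂<s) S≤)
            (Extension.valid E₁) (≤-trans r≤ (Extension.longer E₁)))
        where
        E₁ : Extension U₁ S₁ l r
        E₁ = extend U₁<U S₁⊆U₁ (large-side s≤S₁ rest-light) (≤-trans (<⇒≤ S₁<s) S≤) valid r≤

  -- The neighbourhood has at most Δ · 12K vertices. If it has fewer than 4K, it is padded inside
  -- `U ∖ S` to exactly 4K.
  layer : ∀ {U S : Vtx G → Bool} → 4 * K ≤ countF (U ∖ S) → countF S ≤ 12 * K →
    Σ (Vtx G → Bool) λ S′ → (neighbours G S ∩ (U ∖ S)) ⊆ S′ × S′ ⊆ (U ∖ S) ×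
      4 * K ≤ countF S′ × countF S′ ≤ 12 * (K * Δ)
  layer {U} {S} 4K≤ S≤ = case 4 * K ≤? countF N of λ where
      (yes 4K≤N) → N , (λ _ e → e) , N⊆ , 4K≤N , N≤
      (no 4K≰N)  → let S′ , N⊆S′ , S′⊆ , eq = interpolate (4 * K) N (U ∖ S) N⊆ (<⇒≤ (≰⇒> 4K≰N)) 4K≤
                   in S′ , N⊆S′ , S′⊆ , ≤-reflexive (≡-sym eq) ,
                      ≤-trans (≤-reflexive eq) (*-mono-≤ {4} {12} (m≤m+n 4 8) K≤K*Δ)
    where
    N : Vtx G → Bool
    N = neighbours G S ∩ (U ∖ S)
    N⊆ : N ⊆ (U ∖ S)
    N⊆ v e = proj₂ (∧⁻ {neighbours G S v} e)
    N≤ : countF N ≤ 12 * (K * Δ)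
    N≤ = begin
      countF N                  ≤⟨ countF-mono (λ v e → proj₁ (∧⁻ {neighbours G S v} e)) ⟩
      countF (neighbours G S)   ≤⟨ count-neighbours G S ⟩
      Δ * countF S              ≤⟨ *-monoʳ-≤ Δ S≤ ⟩
      Δ * (12 * K)              ≡⟨ eq Δ K ⟩
      12 * (K * Δ)              ∎
      where
      open ≤-Reasoning
      eq : ∀ x y → x * (12 * y) ≡ 12 * (y * x)
      eq = solve-∀

  remove-< : ∀ {U S : Vtx G → Bool} → S ⊆ U → 4 * K ≤ countF S → countF (U ∖ S) < countF U
  remove-< {U} {S} S⊆U 4K≤ = begin-strict
    countF (U ∖ S)            ≡⟨ +-identityʳ _ ⟨
    countF (U ∖ S) + 0        <⟨ +-monoʳ-< (countF (U ∖ S)) (≤-trans 0<K (≤-trans (m≤m+n K _) 4K≤)) ⟩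
    countF (U ∖ S) + countF S ≤⟨ countF-+-≤ (U ∖ S) S U (λ v → pw (U v) (S v) (S⊆U v)) ⟩
    countF U                  ∎
    where
    open ≤-Reasoning
    pw : ∀ u s → (s ≡ true → u ≡ true) → 𝟙 (u ∧ not s) + 𝟙 s ≤ 𝟙 u
    pw true  true  h = ≤-refl
    pw true  false h = ≤-refl
    pw false true  h with () ← h refl
    pw false false h = z≤n

  extend : ∀ m {U S l r} → countF U < m → S ⊆ U → 4 * K ≤ countF S → countF S ≤ 12 * (K * Δ) →
    Valid l → r ≤ length l → Extension U S l r
  extend (suc m) {U} {S} {l} {r} (s≤s U≤m) S⊆U 4K≤S S≤ valid r≤ with countF (U ∖ S) ≤? w
  ... | yes U∖S≤w = extend-by-leaf S⊆U 4K≤S valid r≤ U∖S≤w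
  ... | no U∖S≰w with countF S ≤? 12 * K
  ...   | no S≰12K = Separated.extend-by-separation S⊆U 4K≤S valid r≤ (balancedSeparation D bag≤K S) (≰⇒> S≰12K) S≤
    λ U′<U S′⊆U′ 4K≤S′ S′≤ valid′ r≤′ → extend m (≤-trans U′<U U≤m) S′⊆U′ 4K≤S′ S′≤ valid′ r≤′
  -- The failed leaf case gives more than `w` ≥ 4K vertices in `U ∖ S`, which is enough for the
  -- padding.
  ...   | yes S≤12K with S′ , N⊆S′ , S′⊆ , 4K≤S′ , S′≤ ← layer {U} {S} (≤-trans 4K≤w (<⇒≤ (≰⇒> U∖S≰w))) S≤12K =
    extend-by-layer S⊆U 4K≤S valid r≤ N⊆S′ S′≤
      (extend m (≤-trans (remove-< {U} {S} S⊆U 4K≤S) U≤m) S′⊆ 4K≤S′ S′≤ (r≤ , valid) ≤-refl)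

  -- Assembling the tree-partition

  TreePartition : Set
  TreePartition = Σ Graph λ T → Σ (Vtx G → Vtx T) λ f →
    IsTree T × maxDegree T ≤ 6 * Δ × IsTPartition G T f × partWidth G T f ≤ w

  everything : Vtx G → Bool
  everything _ = true

  fromExtension : ∀ {S} → countF S ≤ 12 * (K * Δ) → Extension everything S [] 0 → TreePartition
  fromExtension {S} S≤ E = fromParentList G E.l′ E.valid E.f f≤ (6 * Δ) w degrees widths
    (λ v u → E.joined v u refl refl)
    where
    module E = Extension E
    f≤ : ∀ v → E.f v ≤ length E.l′
    f≤ v with E.placed v refl
    ... | inj₁ e rewrite e = z≤n
    ... | inj₂ (_ , ≤len) = ≤len
    degrees : ∀ x → suc (children x E.l′) ≤ 6 * Δ
    degrees zero    = root-degree (subst (2 * K * suc (children 0 E.l′) ≤_) no-children E.children-root) S≤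
      where
      no-children : countF S + 2 * K * 0 ≡ countF S
      no-children rewrite *-zeroʳ (2 * K) = +-identityʳ _
    degrees (suc x) = E.children-new (suc x) (s≤s z≤n)
    widths : ∀ x → countF (preimage E.f x) ≤ w
    widths zero    = half-width E.width-root S≤
    widths (suc x) = E.width-new (suc x) (s≤s z≤n)

  treePartition : TreePartition
  treePartition with countF everything ≤? w
  ... | yes ≤w = fromParentList G [] tt (λ _ → 0) (λ _ → z≤n) (6 * Δ) w (λ _ → 0<6Δ)
    (λ x → ≤-trans (countF-mono {n G} {preimage (λ _ → 0) x} (λ _ _ → refl)) ≤w) (λ _ _ _ → inj₁ refl)
  -- Any 4K vertices can start the induction; the initial tree is the single node 0.
  ... | no ≰w
    with S , _ , _ , S≡ ← interpolate (4 * K) (λ _ → false) everything (λ _ ())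
           (≤-trans (≤-reflexive (countF-empty {n G} (λ _ → refl))) z≤n) (≤-trans 4K≤w (<⇒≤ (≰⇒> ≰w))) =
    fromExtension S≤ (extend _ ≤-refl (λ _ _ → refl) (≤-reflexive (≡-sym S≡)) S≤ tt z≤n)
    where
    S≤ = ≤-trans (≤-reflexive S≡) (*-mono-≤ {4} {12} (m≤m+n 4 8) K≤K*Δ)

-- Reduction of the theorem to the construction

0<maxDegree : ∀ G → NonTrivial G → 0 < maxDegree G
0<maxDegree G (x , y , e) = begin-strict
  0                  <⟨ ≤-refl ⟩
  1                  ≡⟨ cong 𝟙 e ⟨
  𝟙 (adj G x y)      ≤⟨ term≤sumF (𝟙 ∘ adj G x) y ⟩
  degree G x         ≤⟨ term≤maxF (degree G) x ⟩
  maxDegree G        ∎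
  where open ≤-Reasoning

bag-size : ∀ {G k} (D : TreeDecomposition G) → tdWidth D ≡ k → ∀ t → countF (TreeDecomposition.bag D t) ≤ k + 1
bag-size {k = k} D refl t = begin
  countF (bag t)             ≤⟨ term≤maxF (λ t → countF (bag t)) t ⟩
  M                          ≤⟨ m≤n+m∸n M 1 ⟩
  1 + (M ∸ 1)                ≡⟨ +-comm 1 (M ∸ 1) ⟩
  M ∸ 1 + 1                  ∎
  where
  open ≤-Reasoning
  open TreeDecomposition D
  M = maxF (λ t → countF (bag t))

-- The truncated subtraction is exact because Δ > 0 gives 9Δ ≥ 1.
width-identity : ∀ K Δ → 0 < Δ → 2 * K * (9 * Δ ∸ 1) + 2 * K ≡ 18 * (K * Δ)
width-identity K Δ 0<Δ = trans (≡-sym (eq₁ K (9 * Δ ∸ 1)))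
  (trans (cong (2 * K *_) (m+[n∸m]≡n {1} {9 * Δ} (≤-trans 0<Δ (m≤m+n Δ _)))) (eq₂ K Δ))
  where
  eq₁ : ∀ k x → 2 * k * (1 + x) ≡ 2 * k * x + 2 * k
  eq₁ = solve-∀
  eq₂ : ∀ k x → 2 * k * (9 * x) ≡ 18 * (k * x)
  eq₂ = solve-∀

theorem6 : (G : Graph) (k : ℕ) → IsTreewidth G k → NonTrivial G →
    Σ Graph λ T → Σ (Vtx G → Vtx T) λ f →
    IsTree T × maxDegree T ≤ 6 * maxDegree G ×
    IsTPartition G T f ×
    partWidth G T f ≤ 2 * (k + 1) * (9 * maxDegree G ∸ 1)
theorem6 G k ((D , width≡k) , _) nontrivial = Construction.treePartition G D (k + 1)
  (bag-size D width≡k) (m≤n+m 1 k) (0<maxDegree G nontrivial) _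
  (width-identity (k + 1) (maxDegree G) (0<maxDegree G nontrivial))
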